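{- There is no order function $q\colon \mathbb{N} \to (1,\infty)$ such that $\mathrm{LUA}_{\mathrm{slow}} \equiv_{\mathrm{w}} \mathrm{LUA}(q)$.
   Context: An order function is a computable (i.e. its values are uniformly computable reals), nondecreasing, unbounded function $\mathbb{N}\to\mathbb{R}$. An order function $q\colon\mathbb{N}\to(1,\infty)$ is slow-growing if $\sum_{n=0}^\infty q(n)^{ -1}=\infty$. A partial recursive $\psi\colon\subseteq\mathbb{N}\to\mathbb{N}$ is linearly universal if for every partial recursive $\theta\colon\subseteq\mathbb{N}\to\mathbb{N}$ there are $a,b\in\mathbb{N}$ with $\psi(ax+b)\simeq\theta(x)$ for all $x$. For $p\colon\mathbb{N}\to(1,\infty)$, $\mathrm{LUA}(p)$ is the set of $X\in\mathbb{N}^{\mathbb{N}}$ such that $X(n)<p(n)$ for all $n$ and, for some linearly universal partial recursive $\psi$, there is no $n\in\operatorname{dom}\psi$ with $X(n)=\psi(n)$. $\mathrm{LUA}_{\mathrm{slow}}=\bigcup\{\mathrm{LUA}(q) : q\colon\mathbb{N}\to(1,\infty)\text{ a slow-growing order function}\}$. For $P,Q\subseteq\mathbb{N}^{\mathbb{N}}$, $P\leq_{\mathrm{w}}Q$ means every $Y\in Q$ Turing-computes some $X\in P$; $P\equiv_{\mathrm{w}}Q$ means $P\leq_{\mathrm{w}}Q$ and $Q\leq_{\mathrm{w}}P$. -}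

module Defs where

open import Data.Empty using (⊥)
open import Data.Fin.Base using (Fin)
open import Data.Integer.Base using (_⊖_; +_)
open import Data.Nat.Base as ℕ using (ℕ; zero; suc; _≤_; _<_)
import Data.Nat.Properties as ℕ
open import Data.Product.Base using (_×_; _,_; proj₁; proj₂; ∃; ∃-syntax; Σ-syntax)
open import Data.Rational.Base as ℚ using (ℚ; 0ℚ; 1ℚ; ½)
import Data.Rational.Properties as ℚ
open import Data.Rational.Solver using (module +-*-Solver)
open import Data.Sum.Base using (inj₁; inj₂)
open import Data.Unit.Base using (⊤; tt)
open import Data.Vec.Base using (Vec; []; _∷_; lookup)
open import Data.Vec.Relation.Binary.Pointwise.Inductive using (Pointwise)
open import Function.Base using (_∘_)
open import Function.Bundles using (_⇔_)
open import Level using (0ℓ; _⊔_) renaming (suc to lsuc)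
open import Relation.Binary.Core using (Rel)
open import Relation.Binary.PropositionalEquality
open import Relation.Nullary.Negation.Core using (¬_)
open import Relation.Unary using (Pred; _∈_)

------------------------------------------------------------------------
-- Real numbers as Cauchy sequences of rationals.  Different sequences may
-- denote the same real; the order below does not distinguish them.

record ℝ : Set where
  constructor mkℝ
  field
    seq    : ℕ → ℚ
    cauchy : ∀ ε → 0ℚ ℚ.< ε →
             ∃[ N ] (∀ m n → N ≤ m → N ≤ n → ℚ.∣ seq m ℚ.- seq n ∣ ℚ.< ε)

open ℝ public

infix 4 _<ℝ_ _≤ℝ_
infixl 6 _+ℝ_

_<ℝ_ : ℝ → ℝ → Set
x <ℝ y = ∃[ ε ] (0ℚ ℚ.< ε × ∃[ N ] (∀ k → N ≤ k → seq x k ℚ.+ ε ℚ.≤ seq y k))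

_≤ℝ_ : ℝ → ℝ → Set
x ≤ℝ y = ¬ (y <ℝ x)

fromℚ : ℚ → ℝ
fromℚ p .seq _        = p
fromℚ p .cauchy ε 0<ε = 0 , λ _ _ _ _ →
  subst (ℚ._< ε) (cong ℚ.∣_∣ (sym (ℚ.+-inverseʳ p))) 0<ε

fromℕ : ℕ → ℝ
fromℕ n = fromℚ (+ n ℚ./ 1)

private
  half-pos : ∀ {ε} → 0ℚ ℚ.< ε → 0ℚ ℚ.< ½ ℚ.* ε
  half-pos 0<ε = ℚ.*-monoʳ-<-pos ½ 0<ε

  half+half : ∀ ε → ½ ℚ.* ε ℚ.+ ½ ℚ.* ε ≡ ε
  half+half ε = trans (sym (ℚ.*-distribʳ-+ ε ½ ½)) (ℚ.*-identityˡ ε)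

  ∣+-+∣ : ∀ a b c d → ℚ.∣ (a ℚ.+ b) ℚ.- (c ℚ.+ d) ∣ ℚ.≤ ℚ.∣ a ℚ.- c ∣ ℚ.+ ℚ.∣ b ℚ.- d ∣
  ∣+-+∣ a b c d = subst (λ t → ℚ.∣ t ∣ ℚ.≤ ℚ.∣ a ℚ.- c ∣ ℚ.+ ℚ.∣ b ℚ.- d ∣) (sym eq)
     (ℚ.∣p+q∣≤∣p∣+∣q∣ (a ℚ.- c) (b ℚ.- d))
    where
    open +-*-Solver
    eq : (a ℚ.+ b) ℚ.- (c ℚ.+ d) ≡ (a ℚ.- c) ℚ.+ (b ℚ.- d)
    eq = solve 4 (λ a b c d → (a :+ b) :- (c :+ d) := (a :- c) :+ (b :- d)) refl a b c d

_+ℝ_ : ℝ → ℝ → ℝ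
(x +ℝ y) .seq k = seq x k ℚ.+ seq y k
(x +ℝ y) .cauchy ε 0<ε with cauchy x (½ ℚ.* ε) (half-pos 0<ε) | cauchy y (½ ℚ.* ε) (half-pos 0<ε)
... | M , p | N , q = M ℕ.⊔ N , λ m n m≥ n≥ →
  ℚ.≤-<-trans (∣+-+∣ (seq x m) (seq y m) (seq x n) (seq y n))
    (subst (_ ℚ.<_) (half+half ε)
      (ℚ.+-mono-<
        (p m n (ℕ.≤-trans (ℕ.m≤m⊔n M N) m≥) (ℕ.≤-trans (ℕ.m≤m⊔n M N) n≥))
        (q m n (ℕ.≤-trans (ℕ.m≤n⊔m M N) m≥) (ℕ.≤-trans (ℕ.m≤n⊔m M N) n≥))))

-- The open interval (1,∞).
ℝ>1 : Set
ℝ>1 = Σ[ x ∈ ℝ ] fromℚ 1ℚ <ℝ x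

private
  max1-pos : ∀ p → ℚ.Positive (1ℚ ℚ.⊔ p)
  max1-pos p = ℚ.positive (ℚ.<-≤-trans (ℚ.positive⁻¹ 1ℚ) (ℚ.p≤p⊔q 1ℚ p))

recipMax1 : ℚ → ℚ
recipMax1 p = (ℚ.1/ (1ℚ ℚ.⊔ p)) {{ℚ.pos⇒nonZero (1ℚ ℚ.⊔ p) {{max1-pos p}}}}

private
  p≤q+∣p-q∣ : ∀ p q → p ℚ.≤ q ℚ.+ ℚ.∣ p ℚ.- q ∣
  p≤q+∣p-q∣ p q = subst (ℚ._≤ q ℚ.+ ℚ.∣ p ℚ.- q ∣) eq (ℚ.+-monoʳ-≤ q (p≤∣p∣ (p ℚ.- q)))
    where
    open +-*-Solver
    eq : q ℚ.+ (p ℚ.- q) ≡ p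
    eq = solve 2 (λ p q → q :+ (p :- q) := p) refl p q
    p≤∣p∣ : ∀ p → p ℚ.≤ ℚ.∣ p ∣
    p≤∣p∣ p with ℚ.≤-total 0ℚ p
    ... | inj₁ 0≤p = ℚ.≤-reflexive (sym (ℚ.0≤p⇒∣p∣≡p 0≤p))
    ... | inj₂ p≤0 = ℚ.≤-trans p≤0 (ℚ.0≤∣p∣ p)

  ∣p-q∣-sym : ∀ p q → ℚ.∣ p ℚ.- q ∣ ≡ ℚ.∣ q ℚ.- p ∣
  ∣p-q∣-sym p q = trans (cong ℚ.∣_∣ eq) (ℚ.∣-p∣≡∣p∣ (q ℚ.- p))
    where
    open +-*-Solver
    eq : p ℚ.- q ≡ ℚ.- (q ℚ.- p)
    eq = solve 2 (λ p q → p :- q := :- (q :- p)) refl p q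

  recipMax1-≤ : ∀ p q → recipMax1 p ℚ.≤ recipMax1 q ℚ.+ ℚ.∣ p ℚ.- q ∣
  recipMax1-≤ p q = begin
    u'                                ≡⟨ ℚ.*-identityˡ u' ⟨
    1ℚ ℚ.* u'                         ≡⟨ cong (ℚ._* u') v'v≡1 ⟨
    (v' ℚ.* v) ℚ.* u'                 ≤⟨ ℚ.*-monoʳ-≤-nonNeg u' (ℚ.*-monoˡ-≤-nonNeg v' v≤u+d) ⟩
    (v' ℚ.* (u ℚ.+ d)) ℚ.* u'         ≡⟨ shuffle v' u d u' ⟩
    v' ℚ.* (u' ℚ.* u) ℚ.+ (v' ℚ.* d) ℚ.* u'
                                      ≡⟨ cong (λ t → v' ℚ.* t ℚ.+ (v' ℚ.* d) ℚ.* u') u'u≡1 ⟩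
    v' ℚ.* 1ℚ ℚ.+ (v' ℚ.* d) ℚ.* u'   ≡⟨ cong (ℚ._+ (v' ℚ.* d) ℚ.* u') (ℚ.*-identityʳ v') ⟩
    v' ℚ.+ (v' ℚ.* d) ℚ.* u'          ≤⟨ ℚ.+-monoʳ-≤ v' vdu≤d ⟩
    v' ℚ.+ d                          ∎
    where
    open ℚ.≤-Reasoning
    u = 1ℚ ℚ.⊔ p
    v = 1ℚ ℚ.⊔ q
    u' = recipMax1 p
    v' = recipMax1 q
    d = ℚ.∣ p ℚ.- q ∣
    instance
      u-pos : ℚ.Positive u
      u-pos = max1-pos p
      v-pos : ℚ.Positive v
      v-pos = max1-pos q
      u'-nonNeg : ℚ.NonNegative u'
      u'-nonNeg = ℚ.pos⇒nonNeg u' {{ℚ.1/pos⇒pos u}}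
      v'-nonNeg : ℚ.NonNegative v'
      v'-nonNeg = ℚ.pos⇒nonNeg v' {{ℚ.1/pos⇒pos v}}
      d-nonNeg : ℚ.NonNegative d
      d-nonNeg = ℚ.∣-∣-nonNeg (p ℚ.- q)
      vd-nonNeg : ℚ.NonNegative (v' ℚ.* d)
      vd-nonNeg = ℚ.nonNeg*nonNeg⇒nonNeg v' d
    u'u≡1 : u' ℚ.* u ≡ 1ℚ
    u'u≡1 = ℚ.*-inverseˡ u {{ℚ.pos⇒nonZero u}}
    v'v≡1 : v' ℚ.* v ≡ 1ℚ
    v'v≡1 = ℚ.*-inverseˡ v {{ℚ.pos⇒nonZero v}}
    u'≤1 : u' ℚ.≤ 1ℚ
    u'≤1 = subst₂ ℚ._≤_ (ℚ.*-identityʳ u') u'u≡1 (ℚ.*-monoˡ-≤-nonNeg u' (ℚ.p≤p⊔q 1ℚ p))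
    v'≤1 : v' ℚ.≤ 1ℚ
    v'≤1 = subst₂ ℚ._≤_ (ℚ.*-identityʳ v') v'v≡1 (ℚ.*-monoˡ-≤-nonNeg v' (ℚ.p≤p⊔q 1ℚ q))
    vdu≤d : (v' ℚ.* d) ℚ.* u' ℚ.≤ d
    vdu≤d = begin
      (v' ℚ.* d) ℚ.* u'  ≤⟨ ℚ.*-monoˡ-≤-nonNeg (v' ℚ.* d) u'≤1 ⟩
      (v' ℚ.* d) ℚ.* 1ℚ  ≡⟨ ℚ.*-identityʳ (v' ℚ.* d) ⟩
      v' ℚ.* d           ≤⟨ ℚ.*-monoʳ-≤-nonNeg d v'≤1 ⟩
      1ℚ ℚ.* d           ≡⟨ ℚ.*-identityˡ d ⟩
      d                  ∎
    v≤u+d : v ℚ.≤ u ℚ.+ d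
    v≤u+d = ℚ.⊔-lub
      (ℚ.≤-trans (ℚ.p≤p⊔q 1ℚ p) (subst (ℚ._≤ u ℚ.+ d) (ℚ.+-identityʳ u) (ℚ.+-monoʳ-≤ u (ℚ.nonNegative⁻¹ d))))
      (ℚ.≤-trans (p≤q+∣p-q∣ q p)
        (subst (λ t → p ℚ.+ t ℚ.≤ u ℚ.+ d) (∣p-q∣-sym p q) (ℚ.+-monoˡ-≤ d (ℚ.p≤q⊔p 1ℚ p))))
    shuffle : ∀ v' u d u' → (v' ℚ.* (u ℚ.+ d)) ℚ.* u' ≡ v' ℚ.* (u' ℚ.* u) ℚ.+ (v' ℚ.* d) ℚ.* u'
    shuffle = solve 4 (λ v' u d u' →
      (v' :* (u :+ d)) :* u' := v' :* (u' :* u) :+ (v' :* d) :* u') refl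
      where open +-*-Solver

  recipMax1-lipschitz : ∀ p q → ℚ.∣ recipMax1 p ℚ.- recipMax1 q ∣ ℚ.≤ ℚ.∣ p ℚ.- q ∣
  recipMax1-lipschitz p q with ℚ.∣p∣≡p∨∣p∣≡-p (recipMax1 p ℚ.- recipMax1 q)
  ... | inj₁ eq = subst (ℚ._≤ ℚ.∣ p ℚ.- q ∣) (sym eq) (move (recipMax1 p) (recipMax1 q) (recipMax1-≤ p q))
    where
    move : ∀ a b {d} → a ℚ.≤ b ℚ.+ d → a ℚ.- b ℚ.≤ d
    move a b {d} h = subst (a ℚ.- b ℚ.≤_)
      (solve 2 (λ b d → (b :+ d) :- b := d) refl b d) (ℚ.+-monoˡ-≤ (ℚ.- b) h)
      where open +-*-Solver
  ... | inj₂ eq = subst₂ ℚ._≤_ (sym eq) (∣p-q∣-sym q p)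
    (move (recipMax1 q) (recipMax1 p) (recipMax1-≤ q p))
    where
    move : ∀ a b {d} → a ℚ.≤ b ℚ.+ d → ℚ.- (b ℚ.- a) ℚ.≤ d
    move a b {d} h = subst₂ ℚ._≤_
      (solve 2 (λ a b → a :- b := :- (b :- a)) refl a b)
      (solve 2 (λ b d → (b :+ d) :- b := d) refl b d) (ℚ.+-monoˡ-≤ (ℚ.- b) h)
      where open +-*-Solver

-- Reciprocal on (1,∞).  The terms of a sequence denoting a real above 1
-- eventually exceed 1, so replacing each term p by max(1,p) before
-- inverting only affects finitely many terms.
_⁻¹ : ℝ>1 → ℝ
((x , _) ⁻¹) .seq k = recipMax1 (seq x k)
((x , _) ⁻¹) .cauchy ε 0<ε with cauchy x ε 0<ε
... | N , h = N , λ m n m≥ n≥ →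
  ℚ.≤-<-trans (recipMax1-lipschitz (seq x m) (seq x n)) (h m n m≥ n≥)

-- partialSum f n sums f i over i < n.
partialSum : (ℕ → ℝ) → ℕ → ℝ
partialSum f zero    = fromℚ 0ℚ
partialSum f (suc n) = partialSum f n +ℝ f n

SumsToInfinity : (ℕ → ℝ) → Set
SumsToInfinity f = ∀ (B : ℝ) → ∃[ N ] (∀ n → N ≤ n → B <ℝ partialSum f n)

------------------------------------------------------------------------
-- μ-recursive programs of arity n, with one basic unary instruction for
-- each element of O, to be interpreted by oracles.

data Program (O : Set) : ℕ → Set where
  zero   : Program O 0
  succ   : Program O 1
  oracle : O → Program O 1
  proj   : ∀ {n} → Fin n → Program O n
  comp   : ∀ {m n} → Program O m → Vec (Program O n) m → Program O n
  prec   : ∀ {n} → Program O n → Program O (2 ℕ.+ n) → Program O (1 ℕ.+ n)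
  mu     : ∀ {n} → Program O (1 ℕ.+ n) → Program O n

infix 4 _⊢_[_]⇓_

-- F ⊢ e [ xs ]⇓ y : with oracles F, program e halts on xs with output y.
data _⊢_[_]⇓_ {O : Set} (F : O → ℕ → ℕ) : ∀ {n} → Program O n → Vec ℕ n → ℕ → Set where
  zero⇓   : F ⊢ zero [ [] ]⇓ 0
  succ⇓   : ∀ {x} → F ⊢ succ [ x ∷ [] ]⇓ suc x
  oracle⇓ : ∀ {o x} → F ⊢ oracle o [ x ∷ [] ]⇓ F o x
  proj⇓   : ∀ {n} {i : Fin n} {xs} → F ⊢ proj i [ xs ]⇓ lookup xs i
  comp⇓   : ∀ {m n} {f : Program O m} {gs : Vec (Program O n) m} {xs ys z} →
            Pointwise (λ g y → F ⊢ g [ xs ]⇓ y) gs ys →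
            F ⊢ f [ ys ]⇓ z →
            F ⊢ comp f gs [ xs ]⇓ z
  precZ⇓  : ∀ {n} {g : Program O n} {h xs y} →
            F ⊢ g [ xs ]⇓ y →
            F ⊢ prec g h [ 0 ∷ xs ]⇓ y
  precS⇓  : ∀ {n} {g : Program O n} {h xs k r y} →
            F ⊢ prec g h [ k ∷ xs ]⇓ r →
            F ⊢ h [ k ∷ r ∷ xs ]⇓ y →
            F ⊢ prec g h [ suc k ∷ xs ]⇓ y
  mu⇓     : ∀ {n} {f : Program O (1 ℕ.+ n)} {xs y} →
            F ⊢ f [ y ∷ xs ]⇓ 0 →
            (∀ z → z < y → ∃[ w ] F ⊢ f [ z ∷ xs ]⇓ suc w) →
            F ⊢ mu f [ xs ]⇓ y

noOracle : ⊥ → ℕ → ℕ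
noOracle ()

infix 4 _≤T_

_≤T_ : (ℕ → ℕ) → (ℕ → ℕ) → Set
X ≤T Y = Σ[ e ∈ Program ⊤ 1 ] (∀ n → (λ _ → Y) ⊢ e [ n ∷ [] ]⇓ X n)

Computable₂ : (ℕ → ℕ → ℕ) → Set
Computable₂ f = Σ[ e ∈ Program ⊥ 2 ] (∀ m n → noOracle ⊢ e [ m ∷ n ∷ [] ]⇓ f m n)

-- A double sequence of rationals is computable if it can be written as
-- (a − b) / (d + 1) for computable a, b, d.
Computableℚ₂ : (ℕ → ℕ → ℚ) → Set
Computableℚ₂ r = ∃[ a ] ∃[ b ] ∃[ d ] (Computable₂ a × Computable₂ b × Computable₂ d ×
  (∀ m n → r m n ≡ (a m n ⊖ b m n) ℚ./ suc (d m n)))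

2^- : ℕ → ℚ
2^- k = ((+ 1) ℚ./ (2 ℕ.^ k)) {{ℕ.m^n≢0 2 k}}

UniformlyComputable : (ℕ → ℝ) → Set
UniformlyComputable f = Σ[ r ∈ (ℕ → ℕ → ℚ) ] (Computableℚ₂ r ×
  (∀ n k → fromℚ (r n k ℚ.- 2^- k) ≤ℝ f n × f n ≤ℝ fromℚ (r n k ℚ.+ 2^- k)))

record IsOrderFunction (f : ℕ → ℝ) : Set where
  field
    computable    : UniformlyComputable f
    nondecreasing : ∀ m n → m ≤ n → f m ≤ℝ f n
    unbounded     : ∀ (B : ℝ) → ∃[ n ] B <ℝ f n

SlowGrowing : (ℕ → ℝ>1) → Set
SlowGrowing q = SumsToInfinity (λ n → q n ⁻¹)

------------------------------------------------------------------------
-- A partial function is given by its graph: ψ x y means that ψ is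
-- defined at x with value y.  Graphs of partial recursive functions are
-- single-valued because evaluation of programs is.

PartialRecursive : Rel ℕ 0ℓ → Set
PartialRecursive ψ = Σ[ e ∈ Program ⊥ 1 ] (∀ x y → ψ x y ⇔ (noOracle ⊢ e [ x ∷ [] ]⇓ y))

LinearlyUniversal : Rel ℕ 0ℓ → Set₁
LinearlyUniversal ψ = ∀ (θ : Rel ℕ 0ℓ) → PartialRecursive θ →
  ∃[ a ] ∃[ b ] (∀ x y → ψ (a ℕ.* x ℕ.+ b) y ⇔ θ x y)

LUA : (ℕ → ℝ>1) → Pred (ℕ → ℕ) (lsuc 0ℓ)
LUA p X = (∀ n → fromℕ (X n) <ℝ proj₁ (p n)) ×
  Σ[ ψ ∈ Rel ℕ 0ℓ ] (PartialRecursive ψ × LinearlyUniversal ψ ×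
    ¬ (∃[ n ] ∃[ y ] (ψ n y × X n ≡ y)))

LUAslow : Pred (ℕ → ℕ) (lsuc 0ℓ)
LUAslow X = Σ[ q ∈ (ℕ → ℝ>1) ] (IsOrderFunction (proj₁ ∘ q) × SlowGrowing q × X ∈ LUA q)

infix 4 _≤w_ _≡w_

_≤w_ : ∀ {ℓ₁ ℓ₂} → Pred (ℕ → ℕ) ℓ₁ → Pred (ℕ → ℕ) ℓ₂ → Set (ℓ₁ ⊔ ℓ₂)
P ≤w Q = ∀ Y → Y ∈ Q → ∃[ X ] (X ∈ P × X ≤T Y)

_≡w_ : ∀ {ℓ₁ ℓ₂} → Pred (ℕ → ℕ) ℓ₁ → Pred (ℕ → ℕ) ℓ₂ → Set (ℓ₁ ⊔ ℓ₂)
P ≡w Q = P ≤w Q × Q ≤w P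

{-# OPTIONS --safe #-}
module Submission where

-- Only LUA(q) ≤w LUA_slow is contradicted.  Given a computable bound q̂ of q, let growth be a
-- computable function that takes each of its values c exactly c times, so that Σ 1/growth = ∞,
-- but whose new value at each jump n exceeds anything computed from q̂ and the finitely many
-- strings of length n below growth.  A generic function X below growth is built by forcing with
-- bushy trees: a condition is a string s and a set of strings to avoid that is not H-big above s,
-- where H is at most growth beyond s.  The first set to avoid consists of the strings agreeing
-- somewhere with a linearly universal function; it is not 2-big.  To defeat a reduction p and a
-- coding x ↦ a x + b, extend s to have length a jump n and code all these data in a number x.
-- If, for some v, H-big many extensions of s make p output v at a x + b, then a partial
-- recursive diagonal function can find such a v at x, and some such extension is still a
-- condition.  Otherwise no v < q̂ (a x + b) is forced by H-big many extensions, and since the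
-- union of a set that is not H-big and one that is not H′-big is not (H + H′)-big, all these
-- outputs can be avoided from now on, at the cost of a larger H still below growth n.

open import Defs
open import Axiom.ExcludedMiddle using (ExcludedMiddle)
open import Data.Empty using (⊥; ⊥-elim)
open import Data.Fin.Base using (Fin; zero; suc)
import Data.Integer.Base as ℤ
import Data.Integer.Properties as ℤ
open import Data.List.Base using (List; []; _∷_; length; _++_; replicate)
open import Data.List.Properties using (length-replicate)
open import Data.Nat.Base
open import Data.Nat.Properties
open import Data.Nat.Tactic.RingSolver using (solve-∀)
open import Data.Product.Base using (_×_; _,_; Σ-syntax; ∃-syntax; proj₁; proj₂; ∃)
open import Data.Rational.Base as ℚ using (ℚ; 0ℚ; 1ℚ)
import Data.Rational.Properties as ℚ
open import Data.Rational.Solver using (module +-*-Solver)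
open import Data.Rational.Unnormalised.Base as ℚᵘ using (mkℚᵘ; *≡*; *≤*)
import Data.Rational.Unnormalised.Properties as ℚᵘ
open import Data.Sum.Base using (_⊎_; inj₁; inj₂; [_,_]′)
open import Data.Unit.Base using (⊤)
open import Data.Vec.Base using (Vec; []; _∷_; lookup; tabulate)
open import Data.Vec.Properties using (tabulate∘lookup)
open import Data.Vec.Relation.Binary.Pointwise.Inductive using (Pointwise; []; _∷_)
open import Function.Base using (_∘_; id)
open import Function.Bundles using (_⇔_; mk⇔; Equivalence)
open import Level using (0ℓ)
open import Relation.Binary.Core using (Rel)
open import Relation.Binary.Definitions using (tri<; tri≈; tri>)
open import Relation.Binary.PropositionalEquality
open import Relation.Nullary using (Dec; yes; no; contradiction)
open import Relation.Nullary.Negation.Core using (¬_)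
open import Relation.Unary using (_∈_)

-- Determinism of evaluation

mutual
  deterministic : ∀ {O} {F : O → ℕ → ℕ} {n} {e : Program O n} {xs y z} →
    F ⊢ e [ xs ]⇓ y → F ⊢ e [ xs ]⇓ z → y ≡ z
  deterministic zero⇓ zero⇓ = refl
  deterministic succ⇓ succ⇓ = refl
  deterministic oracle⇓ oracle⇓ = refl
  deterministic proj⇓ proj⇓ = refl
  deterministic (comp⇓ ps p) (comp⇓ qs q) with refl ← deterministic* ps qs = deterministic p q
  deterministic (precZ⇓ p) (precZ⇓ q) = deterministic p q
  deterministic (precS⇓ p p′) (precS⇓ q q′) with refl ← deterministic p q = deterministic p′ q′
  deterministic (mu⇓ {y = y} p f) (mu⇓ {y = z} q g) with <-cmp y z
  ... | tri≈ _ y≡z _ = y≡z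
  -- At the smaller of two outputs of one search, one derivation yields the value 0 and the other a
  -- successor.
  ... | tri< y<z _ _ with w , r ← g y y<z with () ← deterministic p r
  ... | tri> _ _ z<y with w , r ← f z z<y with () ← deterministic r q

  deterministic* : ∀ {O} {F : O → ℕ → ℕ} {m n} {gs : Vec (Program O n) m} {xs ys zs} →
    Pointwise (λ g y → F ⊢ g [ xs ]⇓ y) gs ys → Pointwise (λ g y → F ⊢ g [ xs ]⇓ y) gs zs → ys ≡ zs
  deterministic* [] [] = refl
  deterministic* (p ∷ ps) (q ∷ qs) = cong₂ _∷_ (deterministic p q) (deterministic* ps qs)

-- Total computable functions

-- A function travels with a program and its correctness proof, so whatever is written with the
-- combinators below is computable by construction.
record Fn (n : ℕ) : Set where
  constructor mkFn
  field
    fun     : Vec ℕ n → ℕ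
    prog    : Program ⊥ n
    correct : ∀ xs → noOracle ⊢ prog [ xs ]⇓ fun xs

open Fn

-- Replaces the function that the combinators produce by a readable equal one, to which `fun` then
-- reduces.
retarget : ∀ {n} (F : Fn n) (f : Vec ℕ n → ℕ) → (∀ xs → fun F xs ≡ f xs) → Fn n
retarget F f eq = mkFn f (prog F) λ xs → subst (noOracle ⊢ prog F [ xs ]⇓_) (eq xs) (correct F xs)

var : ∀ {n} → Fin n → Fn n
var i = mkFn (λ xs → lookup xs i) (proj i) (λ _ → proj⇓)

funs : ∀ {m n} → Vec (Fn n) m → Vec ℕ n → Vec ℕ m
funs []       xs = []
funs (G ∷ Gs) xs = fun G xs ∷ funs Gs xs

app : ∀ {m n} → Fn m → Vec (Fn n) m → Fn n
app {m} {n} F Gs = mkFn (λ xs → fun F (funs Gs xs)) (comp (prog F) (progs Gs))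
  (λ xs → comp⇓ (corrects Gs xs) (correct F _))
  where
  progs : ∀ {k} → Vec (Fn n) k → Vec (Program ⊥ n) k
  progs []       = []
  progs (G ∷ Gs) = prog G ∷ progs Gs
  corrects : ∀ {k} (Gs : Vec (Fn n) k) xs →
    Pointwise (λ g y → noOracle ⊢ g [ xs ]⇓ y) (progs Gs) (funs Gs xs)
  corrects []       xs = []
  corrects (G ∷ Gs) xs = correct G xs ∷ corrects Gs xs

natrec : ℕ → (ℕ → ℕ → ℕ) → ℕ → ℕ
natrec z s zero    = z
natrec z s (suc k) = s k (natrec z s k)

natrec-cong : ∀ {z s} (f : ℕ → ℕ) → z ≡ f 0 → (∀ k → s k (f k) ≡ f (suc k)) → ∀ k → natrec z s k ≡ f k
natrec-cong f p q zero = p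
natrec-cong {s = s} f p q (suc k) = trans (cong (s k) (natrec-cong f p q k)) (q k)

recur : ∀ {n} → Fn n → Fn (2 + n) → Fn (1 + n)
recur {n} Z S = mkFn f (prec (prog Z) (prog S)) λ { (k ∷ xs) → corr k xs }
  where
  f : Vec ℕ (1 + n) → ℕ
  f (k ∷ xs) = natrec (fun Z xs) (λ k r → fun S (k ∷ r ∷ xs)) k
  corr : ∀ k xs → noOracle ⊢ prec (prog Z) (prog S) [ k ∷ xs ]⇓ f (k ∷ xs)
  corr zero    xs = precZ⇓ (correct Z xs)
  corr (suc k) xs = precS⇓ (corr k xs) (correct S _)

pattern v0 = zero
pattern v1 = suc zero
pattern v2 = suc (suc zero)
pattern v3 = suc (suc (suc zero))
pattern v4 = suc (suc (suc (suc zero)))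
pattern v5 = suc (suc (suc (suc (suc zero))))
pattern v6 = suc (suc (suc (suc (suc (suc zero)))))
pattern v7 = suc (suc (suc (suc (suc (suc (suc zero))))))

fn₁ : (F : Fn 1) (f : ℕ → ℕ) → (∀ x → fun F (x ∷ []) ≡ f x) → Fn 1
fn₁ F f eq = retarget F (λ { (x ∷ []) → f x }) λ { (x ∷ []) → eq x }

fn₂ : (F : Fn 2) (f : ℕ → ℕ → ℕ) → (∀ x y → fun F (x ∷ y ∷ []) ≡ f x y) → Fn 2
fn₂ F f eq = retarget F (λ { (x ∷ y ∷ []) → f x y }) λ { (x ∷ y ∷ []) → eq x y }

fn₃ : (F : Fn 3) (f : ℕ → ℕ → ℕ → ℕ) → (∀ x y z → fun F (x ∷ y ∷ z ∷ []) ≡ f x y z) → Fn 3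
fn₃ F f eq = retarget F (λ { (x ∷ y ∷ z ∷ []) → f x y z }) λ { (x ∷ y ∷ z ∷ []) → eq x y z }

zeroFn : ∀ {n} → Fn n
zeroFn = app (mkFn (λ _ → 0) zero λ { [] → zero⇓ }) []

sucFn : ∀ {n} → Fn n → Fn n
sucFn A = app (mkFn (λ { (x ∷ []) → suc x }) succ λ { (x ∷ []) → succ⇓ }) (A ∷ [])

const : ∀ {n} → ℕ → Fn n
const zero    = zeroFn
const (suc k) = sucFn (const k)

infixl 6 _⊕_ _⊖_
infixl 7 _⊛_

_⊕_ : ∀ {n} → Fn n → Fn n → Fn n
A ⊕ B = app (fn₂ (recur (var v0) (sucFn (var v1))) _+_
  λ x y → natrec-cong (_+ y) refl (λ _ → refl) x) (A ∷ B ∷ [])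

_⊛_ : ∀ {n} → Fn n → Fn n → Fn n
A ⊛ B = app (fn₂ (recur zeroFn (var v2 ⊕ var v1)) _*_
  λ x y → natrec-cong (_* y) refl (λ _ → refl) x) (A ∷ B ∷ [])

predFn : ∀ {n} → Fn n → Fn n
predFn A = app (fn₁ (recur zeroFn (var v0)) pred (natrec-cong pred refl (λ _ → refl))) (A ∷ [])

_⊖_ : ∀ {n} → Fn n → Fn n → Fn n
A ⊖ B = app (fn₂ (recur (var v0) (predFn (var v1))) (λ y x → x ∸ y)
  λ y x → natrec-cong (x ∸_) refl (λ k → pred[m∸n]≡m∸[1+n] x k) y) (B ∷ A ∷ [])

ifz : ℕ → ℕ → ℕ → ℕ
ifz zero    a b = a
ifz (suc _) a b = b

ifzFn : ∀ {n} → Fn n → Fn n → Fn n → Fn n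
ifzFn C A B = app (fn₃ (recur (var v0) (var v3)) ifz
  λ x a b → natrec-cong (λ c → ifz c a b) refl (λ _ → refl) x) (C ∷ A ∷ B ∷ [])

sgn : ℕ → ℕ
sgn zero    = 0
sgn (suc _) = 1

sgnFn : ∀ {n} → Fn n → Fn n
sgnFn A = app (fn₁ (recur zeroFn (const 1)) sgn (natrec-cong sgn refl (λ _ → refl))) (A ∷ [])

dist : ℕ → ℕ → ℕ
dist x y = (x ∸ y) + (y ∸ x)

distFn : ∀ {n} → Fn n → Fn n → Fn n
distFn A B = app (fn₂ ((var v0 ⊖ var v1) ⊕ (var v1 ⊖ var v0)) dist λ _ _ → refl) (A ∷ B ∷ [])

dist-refl : ∀ x → dist x x ≡ 0
dist-refl x rewrite n∸n≡0 x = refl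

dist≡0⇒≡ : ∀ x y → dist x y ≡ 0 → x ≡ y
dist≡0⇒≡ x y eq = ≤-antisym (m∸n≡0⇒m≤n (m+n≡0⇒m≡0 (x ∸ y) eq)) (m∸n≡0⇒m≤n (m+n≡0⇒n≡0 (x ∸ y) eq))

-- Bounded sums and iteration

sum : (ℕ → ℕ) → ℕ → ℕ
sum f zero    = 0
sum f (suc k) = f k + sum f k

sum-cong : ∀ {f g} n → (∀ i → i < n → f i ≡ g i) → sum f n ≡ sum g n
sum-cong zero    eq = refl
sum-cong (suc n) eq = cong₂ _+_ (eq n ≤-refl) (sum-cong n λ i i<n → eq i (m≤n⇒m≤1+n i<n))

sum-shift : ∀ f n → sum f (suc n) ≡ f 0 + sum (f ∘ suc) n
sum-shift f zero    = refl
sum-shift f (suc n) = begin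
  f (suc n) + sum f (suc n)              ≡⟨ cong (f (suc n) +_) (sum-shift f n) ⟩
  f (suc n) + (f 0 + sum (f ∘ suc) n)    ≡⟨ lemma (f (suc n)) (f 0) _ ⟩
  f 0 + (f (suc n) + sum (f ∘ suc) n)    ∎
  where
  open ≡-Reasoning
  lemma : ∀ a b c → a + (b + c) ≡ b + (a + c)
  lemma = solve-∀

term≤sum : ∀ f {i n} → i < n → f i ≤ sum f n
term≤sum f {i} {suc n} i<sn with m≤n⇒m<n∨m≡n (s≤s⁻¹ i<sn)
... | inj₁ i<n  = ≤-trans (term≤sum f i<n) (m≤n+m _ _)
... | inj₂ refl = m≤m+n _ _

iter : (ℕ → ℕ) → ℕ → ℕ → ℕ
iter f zero    x = x
iter f (suc k) x = f (iter f k x)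

iter-shift : ∀ f k x → iter f (suc k) x ≡ iter f k (f x)
iter-shift f zero    x = refl
iter-shift f (suc k) x = cong f (iter-shift f k x)

iter-+ : ∀ f j k x → iter f (j + k) x ≡ iter f j (iter f k x)
iter-+ f zero    k x = refl
iter-+ f (suc j) k x = cong f (iter-+ f j k x)

iter-fixed : ∀ f k {x} → f x ≡ x → iter f k x ≡ x
iter-fixed f zero    eq = refl
iter-fixed f (suc k) eq = trans (cong f (iter-fixed f k eq)) eq

vars : ∀ {m n} → (Fin m → Fin n) → Vec (Fn n) m
vars f = tabulate (λ i → var (f i))

funs-vars : ∀ {m n} (f : Fin m → Fin n) xs → funs (vars f) xs ≡ tabulate (λ i → lookup xs (f i))
funs-vars {zero}  f xs = refl
funs-vars {suc m} f xs = cong (lookup xs (f zero) ∷_) (funs-vars (f ∘ suc) xs)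

funs-drop₂ : ∀ {n a b} (xs : Vec ℕ n) → funs (vars (λ i → suc (suc i))) (a ∷ b ∷ xs) ≡ xs
funs-drop₂ xs = trans (funs-vars (λ i → suc (suc i)) _) (tabulate∘lookup xs)

funs-drop₃ : ∀ {n a b c} (xs : Vec ℕ n) → funs (vars (λ i → suc (suc (suc i)))) (a ∷ b ∷ c ∷ xs) ≡ xs
funs-drop₃ xs = trans (funs-vars (λ i → suc (suc (suc i))) _) (tabulate∘lookup xs)

sumFn : ∀ {n} → Fn (suc n) → Fn (suc n)
sumFn F = retarget (recur zeroFn (app F (var v0 ∷ vars (λ i → suc (suc i))) ⊕ var v1))
  (λ { (k ∷ xs) → sum (λ i → fun F (i ∷ xs)) k })
  λ { (k ∷ xs) → natrec-cong (sum (λ i → fun F (i ∷ xs))) refl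
        (λ i → cong (λ ys → fun F (i ∷ ys) + sum (λ i → fun F (i ∷ xs)) i) (funs-drop₂ xs)) k }

iterFn : ∀ {n} → Fn (suc n) → Fn (2 + n)
iterFn F = retarget (recur (var v0) (app F (var v1 ∷ vars (λ i → suc (suc (suc i))))))
  (λ { (k ∷ x ∷ xs) → iter (λ y → fun F (y ∷ xs)) k x })
  λ { (k ∷ x ∷ xs) → natrec-cong (λ k → iter (λ y → fun F (y ∷ xs)) k x) refl
        (λ k → cong (λ ys → fun F (iter (λ y → fun F (y ∷ xs)) k x ∷ ys)) (funs-drop₃ xs)) k }

-- Unbounded search

Least : (ℕ → ℕ) → ℕ → Set
Least f y = f y ≡ 0 × (∀ z → z < y → ∃[ w ] f z ≡ suc w)

-- Whether f vanishes below a bound is settled by checking finitely many values, so no classical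
-- principle enters. The result has the shape of the premises of `mu⇓`.
least : ∀ f y → f y ≡ 0 → ∃ (Least f)
least f y fy≡0 with below (suc y)
  where
  below : ∀ k → ∃ (Least f) ⊎ (∀ z → z < k → ∃[ w ] f z ≡ suc w)
  below zero = inj₂ λ _ ()
  below (suc k) with below k
  ... | inj₁ l = inj₁ l
  ... | inj₂ h with f k in eq
  ...   | zero  = inj₁ (k , eq , h)
  ...   | suc w = inj₂ step
    where
    step : ∀ z → z < suc k → ∃[ w ] f z ≡ suc w
    step z z<sk with m≤n⇒m<n∨m≡n (s≤s⁻¹ z<sk)
    ... | inj₁ z<k  = h z z<k
    ... | inj₂ refl = w , eq
... | inj₁ l = l
... | inj₂ h with w , eq ← h y ≤-refl with () ← trans (sym fy≡0) eq

-- As in Kleene's normal form, F tests candidates for a halting witness and G reads the output off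
-- the first one that passes.
search : ∀ {n} → Fn (suc n) → Fn (suc n) → Program ⊥ n
search F G = comp (prog G) (mu (prog F) ∷ tabulate proj)

proj⇓* : ∀ {n} (xs : Vec ℕ n) {m} (f : Fin m → Fin n) →
  Pointwise (λ g y → noOracle ⊢ g [ xs ]⇓ y) (tabulate (λ i → proj (f i))) (tabulate (λ i → lookup xs (f i)))
proj⇓* xs {zero}  f = []
proj⇓* xs {suc m} f = proj⇓ ∷ proj⇓* xs (f ∘ suc)

search⇓ : ∀ {n} (F G : Fn (suc n)) xs y → fun F (y ∷ xs) ≡ 0 →
  ∃[ y₀ ] fun F (y₀ ∷ xs) ≡ 0 × noOracle ⊢ search F G [ xs ]⇓ fun G (y₀ ∷ xs)
search⇓ F G xs y eq with y₀ , eq₀ , min ← least (λ y → fun F (y ∷ xs)) y eq =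
  y₀ , eq₀ , comp⇓
    (mu⇓ (subst (noOracle ⊢ prog F [ y₀ ∷ xs ]⇓_) eq₀ (correct F _))
         (λ z z<y₀ → proj₁ (min z z<y₀) ,
           subst (noOracle ⊢ prog F [ z ∷ xs ]⇓_) (proj₂ (min z z<y₀)) (correct F _))
     ∷ subst (Pointwise _ (tabulate proj)) (tabulate∘lookup xs) (proj⇓* xs id))
    (correct G _)

search⇓⁻¹ : ∀ {n} (F G : Fn (suc n)) xs {w} → noOracle ⊢ search F G [ xs ]⇓ w →
  ∃[ y₀ ] fun F (y₀ ∷ xs) ≡ 0 × w ≡ fun G (y₀ ∷ xs)
search⇓⁻¹ F G xs (comp⇓ {ys = y₀ ∷ ys} (mu⇓ p _ ∷ ps) q)
  with refl ← deterministic* ps (subst (Pointwise _ (tabulate proj)) (tabulate∘lookup xs) (proj⇓* xs id)) =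
  y₀ , deterministic (correct F _) p , deterministic q (correct G _)

-- Pairing

par : ℕ → ℕ
par zero    = 0
par (suc n) = 1 ∸ par n

half : ℕ → ℕ
half zero    = 0
half (suc n) = par n + half n

par-even : ∀ n → par (n + n) ≡ 0
par-even zero = refl
par-even (suc n) rewrite +-suc n n | par-even n = refl

half-even : ∀ n → half (n + n) ≡ n
half-even zero = refl
half-even (suc n) rewrite +-suc n n | par-even n | half-even n = refl

-- Cancels a factor 2 if there is one. Odd numbers are fixed, so iterating too often does no harm,
-- and on the code z of (e, x) z iterations suffice because e < z.
shift : ℕ → ℕ
shift z = ifz (par z) (half z) z

-- The pair (e, x) is coded as 2^e (2x + 1), because this is linear in x.
pairᵈ : ℕ → ℕ → ℕ
pairᵈ zero    x = suc (x + x)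
pairᵈ (suc e) x = pairᵈ e x + pairᵈ e x

shift-odd : ∀ x → shift (suc (x + x)) ≡ suc (x + x)
shift-odd x rewrite par-even x = refl

shift-double : ∀ z → shift (z + z) ≡ z
shift-double z rewrite par-even z = half-even z

iter-shift-pairᵈ : ∀ e x k → e ≤ k → iter shift k (pairᵈ e x) ≡ suc (x + x)
iter-shift-pairᵈ zero x k _ = iter-fixed shift k (shift-odd x)
iter-shift-pairᵈ (suc e) x (suc k) (s≤s e≤k) = trans (iter-shift shift k _)
  (trans (cong (iter shift k) (shift-double (pairᵈ e x))) (iter-shift-pairᵈ e x k e≤k))

-- For positive z and large enough k this is the exponent of 2 in z.
countEven : ℕ → ℕ → ℕ
countEven k z = sum (λ i → 1 ∸ par (iter shift i z)) k

countEven-pairᵈ : ∀ e x k → e ≤ k → countEven k (pairᵈ e x) ≡ e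
countEven-pairᵈ zero x zero _ = refl
countEven-pairᵈ zero x (suc k) _
  rewrite iter-fixed shift k (shift-odd x) | par-even x = countEven-pairᵈ zero x k z≤n
countEven-pairᵈ (suc e) x (suc k) (s≤s e≤k) = begin
  countEven (suc k) (pairᵈ (suc e) x)
    ≡⟨ sum-shift (λ i → 1 ∸ par (iter shift i (pairᵈ (suc e) x))) k ⟩
  (1 ∸ par (pairᵈ (suc e) x)) + sum (λ i → 1 ∸ par (iter shift (suc i) (pairᵈ (suc e) x))) k
    ≡⟨ cong₂ _+_ (cong (1 ∸_) (par-even (pairᵈ e x)))
         (sum-cong k λ i _ → cong (λ w → 1 ∸ par w)
           (trans (iter-shift shift i _) (cong (iter shift i) (shift-double (pairᵈ e x))))) ⟩
  suc (countEven k (pairᵈ e x))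
    ≡⟨ cong suc (countEven-pairᵈ e x k e≤k) ⟩
  suc e ∎
  where open ≡-Reasoning

0<pairᵈ : ∀ e x → 0 < pairᵈ e x
0<pairᵈ zero    x = s≤s z≤n
0<pairᵈ (suc e) x = ≤-trans (0<pairᵈ e x) (m≤m+n _ _)

e<pairᵈ : ∀ e x → e < pairᵈ e x
e<pairᵈ zero    x = s≤s z≤n
e<pairᵈ (suc e) x = +-mono-≤ (0<pairᵈ e x) (e<pairᵈ e x)

pairᵈ-mono : ∀ {d e x y} → d ≤ e → x ≤ y → pairᵈ d x ≤ pairᵈ e y
pairᵈ-mono {e = zero}  z≤n       x≤y = s≤s (+-mono-≤ x≤y x≤y)
pairᵈ-mono {e = suc e} z≤n       x≤y = ≤-trans (pairᵈ-mono {e = e} z≤n x≤y) (m≤m+n _ _)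
pairᵈ-mono             (s≤s d≤e) x≤y = +-mono-≤ (pairᵈ-mono d≤e x≤y) (pairᵈ-mono d≤e x≤y)

pairᵈ-linear : ∀ e x → pairᵈ e x ≡ (2 ^ suc e) * x + 2 ^ e
pairᵈ-linear zero    x = lemma x
  where
  lemma : ∀ x → suc (x + x) ≡ 2 * x + 1
  lemma = solve-∀
pairᵈ-linear (suc e) x = trans (cong₂ _+_ (pairᵈ-linear e x) (pairᵈ-linear e x)) (lemma (2 ^ e) x)
  where
  lemma : ∀ c x → ((2 * c) * x + c) + ((2 * c) * x + c) ≡ (2 * (2 * c)) * x + 2 * c
  lemma = solve-∀

parFn : Fn 1
parFn = fn₁ (recur zeroFn (const 1 ⊖ var v1)) par (natrec-cong par refl λ _ → refl)

halfFn : Fn 1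
halfFn = fn₁ (recur zeroFn (app parFn (var v0 ∷ []) ⊕ var v1)) half (natrec-cong half refl λ _ → refl)

shiftFn : Fn 1
shiftFn = ifzFn (app parFn (var v0 ∷ [])) (app halfFn (var v0 ∷ [])) (var v0)

shiftsFn : Fn 2
shiftsFn = fn₂ (recur (var v0) (app shiftFn (var v1 ∷ []))) (iter shift)
  λ k x → natrec-cong (λ k → iter shift k x) refl (λ _ → refl) k

-- Opaque so that codes of concrete data are never unfolded; from here on only the laws of this
-- block are used.
opaque
  pair : ℕ → ℕ → ℕ
  pair = pairᵈ

  fst snd : ℕ → ℕ
  fst z = countEven z z
  snd z = half (iter shift z z)

  fst-pair : ∀ e x → fst (pair e x) ≡ e
  fst-pair e x = countEven-pairᵈ e x _ (<⇒≤ (e<pairᵈ e x))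

  snd-pair : ∀ e x → snd (pair e x) ≡ x
  snd-pair e x rewrite iter-shift-pairᵈ e x _ (<⇒≤ (e<pairᵈ e x)) | par-even x = half-even x

  pair-mono : ∀ {d e x y} → d ≤ e → x ≤ y → pair d x ≤ pair e y
  pair-mono = pairᵈ-mono

  pair-linear : ∀ e x → pair e x ≡ (2 ^ suc e) * x + 2 ^ e
  pair-linear = pairᵈ-linear

  pairFn′ : Fn 2
  pairFn′ = recur (sucFn (var v0 ⊕ var v0)) (var v1 ⊕ var v1)

  pairFn′-correct : ∀ e x → fun pairFn′ (e ∷ x ∷ []) ≡ pair e x
  pairFn′-correct e x = natrec-cong (λ e → pair e x) refl (λ _ → refl) e

  fstFn′ : Fn 1
  fstFn′ = app (sumFn (const 1 ⊖ app parFn (app shiftsFn (var v0 ∷ var v1 ∷ []) ∷ [])))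
    (var v0 ∷ var v0 ∷ [])

  fstFn′-correct : ∀ z → fun fstFn′ (z ∷ []) ≡ fst z
  fstFn′-correct z = refl

  sndFn′ : Fn 1
  sndFn′ = app halfFn (app shiftsFn (var v0 ∷ var v0 ∷ []) ∷ [])

  sndFn′-correct : ∀ z → fun sndFn′ (z ∷ []) ≡ snd z
  sndFn′-correct z = refl

pairFn : ∀ {n} → Fn n → Fn n → Fn n
pairFn A B = app (fn₂ pairFn′ pair pairFn′-correct) (A ∷ B ∷ [])

fstFn sndFn : ∀ {n} → Fn n → Fn n
fstFn A = app (fn₁ fstFn′ fst fstFn′-correct) (A ∷ [])
sndFn A = app (fn₁ sndFn′ snd sndFn′-correct) (A ∷ [])

-- Finite oracles

-- A finite string is a list with its last entry at the head.
String : Set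
String = List ℕ

code : String → ℕ
code []      = 0
code (i ∷ s) = pair (code s) i

-- The last entry of a string is outermost in its code, so entry j of n lies under n - 1 - j
-- applications of `fst`.
entry : ℕ → ℕ → ℕ → ℕ
entry n σ j = snd (iter fst (n ∸ suc j) σ)

at : String → ℕ → ℕ
at s j = entry (length s) (code s) j

at-last : ∀ i s → at (i ∷ s) (length s) ≡ i
at-last i s rewrite n∸n≡0 (length s) = snd-pair (code s) i

at-∷ : ∀ i s {j} → j < length s → at (i ∷ s) j ≡ at s j
at-∷ i s {j} j<n = cong snd (begin
  iter fst (suc (length s) ∸ suc j) (pair (code s) i)
    ≡⟨ cong (λ k → iter fst k (pair (code s) i)) (+-∸-assoc 1 j<n) ⟩
  iter fst (suc (length s ∸ suc j)) (pair (code s) i)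
    ≡⟨ iter-shift fst (length s ∸ suc j) _ ⟩
  iter fst (length s ∸ suc j) (fst (pair (code s) i))
    ≡⟨ cong (iter fst (length s ∸ suc j)) (fst-pair (code s) i) ⟩
  iter fst (length s ∸ suc j) (code s) ∎)
  where open ≡-Reasoning

-- One string answers all oracles. For O = ⊤ it is a finite part of the oracle; for O = ⊥ the
-- condition is vacuous, so one machine serves both cases.
Agree : {O : Set} → (O → ℕ → ℕ) → String → Set
Agree F s = ∀ o k → k < length s → F o k ≡ at s k

-- A universal stack machine: a state pairs a stack of instructions with a value.

-- The successor tells a nonempty stack from the empty stack 0, which marks a halted state.
push : ℕ → ℕ → ℕ
push k K = suc (pair k K)

ins : ℕ → ℕ → ℕ → ℕ → ℕ
ins t a b d = pair t (pair a (pair b d))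

pushFn : ∀ {n} → Fn n → Fn n → Fn n
pushFn A B = sucFn (pairFn A B)

insFn : ∀ {n} → ℕ → Fn n → Fn n → Fn n → Fn n
insFn t A B D = pairFn (const t) (pairFn A (pairFn B D))

entryFn : Fn 3
entryFn = sndFn (app (iterFn (fstFn (var v0))) ((var v0 ⊖ sucFn (var v2)) ∷ var v1 ∷ []))

switch : ∀ {n k} → Fn n → Vec (Fn n) k → Fn n
switch T []       = zeroFn
switch T (A ∷ As) = ifzFn T A (switch (predFn T) As)

-- The tags: 0 zero, 1 succ, 2 oracle, 3 and 4 projections, 5 comp, 6 and 7 lists of programs
-- (8 saves the tail, 9 the value of the head), 10 prec (11 saves the step), 12 mu (13 tests a value).
-- An oracle query outside the finite oracle leaves the state unchanged, so that it never halts.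
execFn : Fn 8
execFn = switch (var v0)
  ( pairFn K zeroFn
  ∷ pairFn K (sucFn (fstFn v))
  ∷ ifzFn (sucFn (fstFn v) ⊖ n) (pairFn K (app entryFn (n ∷ σ ∷ fstFn v ∷ [])))
      (pairFn (pushFn (insFn 2 zeroFn zeroFn zeroFn) K) v)
  ∷ pairFn K (fstFn v)
  ∷ pairFn (pushFn a K) (sndFn v)
  ∷ pairFn (pushFn b (pushFn a K)) v
  ∷ pairFn K zeroFn
  ∷ pairFn (pushFn a (pushFn (insFn 8 b v zeroFn) K)) v
  ∷ pairFn (pushFn a (pushFn (insFn 9 v zeroFn zeroFn) K)) b
  ∷ pairFn K (pairFn a v)
  ∷ ifzFn (fstFn v) (pairFn (pushFn a K) (sndFn v))
      (pairFn (pushFn (insFn 10 a b zeroFn) (pushFn (insFn 11 b (predFn (fstFn v)) (sndFn v)) K))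
        (pairFn (predFn (fstFn v)) (sndFn v)))
  ∷ pairFn (pushFn a K) (pairFn b (pairFn v d))
  ∷ pairFn (pushFn a (pushFn (insFn 13 a zeroFn v) K)) (pairFn zeroFn v)
  ∷ ifzFn v (pairFn K b)
      (pairFn (pushFn a (pushFn (insFn 13 a (sucFn b) d) K)) (pairFn (sucFn b) d))
  ∷ [])
  where
  a b d K v n σ : Fn 8
  a = var v1
  b = var v2
  d = var v3
  K = var v4
  v = var v5
  n = var v6
  σ = var v7

stepFn : Fn 3
-- Halted states are fixed points, so a run may be continued beyond its end.
stepFn = ifzFn (fstFn (var v0)) (var v0)
  (app execFn (fstFn i ∷ fstFn (sndFn i) ∷ fstFn (sndFn (sndFn i)) ∷ sndFn (sndFn (sndFn i)) ∷
    sndFn (predFn (fstFn (var v0))) ∷ sndFn (var v0) ∷ var v1 ∷ var v2 ∷ []))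
  where
  i : Fn 3
  i = fstFn (predFn (fstFn (var v0)))

exec : ℕ → ℕ → ℕ → ℕ → ℕ → ℕ → ℕ → ℕ → ℕ
exec t a b d K v n σ = fun execFn (t ∷ a ∷ b ∷ d ∷ K ∷ v ∷ n ∷ σ ∷ [])

opaque
  step : ℕ → ℕ → ℕ → ℕ
  step n σ st = fun stepFn (st ∷ n ∷ σ ∷ [])

  step-correct : ∀ st n σ → fun stepFn (st ∷ n ∷ σ ∷ []) ≡ step n σ st
  step-correct st n σ = refl

  step-halted : ∀ n σ w → step n σ (pair 0 w) ≡ pair 0 w
  step-halted n σ w rewrite fst-pair 0 w = refl

  step-ins : ∀ t a b d K v n σ → step n σ (pair (push (ins t a b d) K) v) ≡ exec t a b d K v n σ
  step-ins t a b d K v n σ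
    rewrite fst-pair (push (ins t a b d) K) v | snd-pair (push (ins t a b d) K) v
          | fst-pair (ins t a b d) K | snd-pair (ins t a b d) K
          | fst-pair t (pair a (pair b d)) | snd-pair t (pair a (pair b d))
          | fst-pair a (pair b d) | snd-pair a (pair b d) | fst-pair b d | snd-pair b d = refl

module _ {n : ℕ} (σ : ℕ) where

  step-zero : ∀ K v → step n σ (pair (push (ins 0 0 0 0) K) v) ≡ pair K 0
  step-zero K v = step-ins 0 0 0 0 K v n σ

  step-succ : ∀ K x v → step n σ (pair (push (ins 1 0 0 0) K) (pair x v)) ≡ pair K (suc x)
  step-succ K x v = trans (step-ins 1 0 0 0 K _ n σ) (cong (λ y → pair K (suc y)) (fst-pair x v))

  step-oracle : ∀ K x v → x < n →
    step n σ (pair (push (ins 2 0 0 0) K) (pair x v)) ≡ pair K (entry n σ x)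
  step-oracle K x v x<n = trans (step-ins 2 0 0 0 K _ n σ) (trans
    (cong (λ y → ifz (suc y ∸ n) (pair K (entry n σ y)) (pair (push (ins 2 0 0 0) K) (pair x v))) (fst-pair x v))
    (cong (λ z → ifz z (pair K (entry n σ x)) (pair (push (ins 2 0 0 0) K) (pair x v))) (m≤n⇒m∸n≡0 x<n)))

  step-stuck : ∀ K x v → ¬ x < n →
    step n σ (pair (push (ins 2 0 0 0) K) (pair x v)) ≡ pair (push (ins 2 0 0 0) K) (pair x v)
  step-stuck K x v x≮n = trans (step-ins 2 0 0 0 K _ n σ) (trans
    (cong (λ y → ifz (suc y ∸ n) (pair K (entry n σ y)) (pair (push (ins 2 0 0 0) K) (pair x v))) (fst-pair x v))
    (stuck (suc x ∸ n) λ eq → x≮n (m∸n≡0⇒m≤n eq)))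
    where
    stuck : ∀ k {a b} → ¬ k ≡ 0 → ifz k a b ≡ b
    stuck zero    k≢0 = contradiction refl k≢0
    stuck (suc _) _   = refl

  step-proj0 : ∀ K x v → step n σ (pair (push (ins 3 0 0 0) K) (pair x v)) ≡ pair K x
  step-proj0 K x v = trans (step-ins 3 0 0 0 K _ n σ) (cong (pair K) (fst-pair x v))

  step-projS : ∀ a K x v → step n σ (pair (push (ins 4 a 0 0) K) (pair x v)) ≡ pair (push a K) v
  step-projS a K x v = trans (step-ins 4 a 0 0 K _ n σ) (cong (pair (push a K)) (snd-pair x v))

  step-comp : ∀ f gs K v → step n σ (pair (push (ins 5 f gs 0) K) v) ≡ pair (push gs (push f K)) v
  step-comp f gs K v = step-ins 5 f gs 0 K v n σ

  step-nil : ∀ K v → step n σ (pair (push (ins 6 0 0 0) K) v) ≡ pair K 0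
  step-nil K v = step-ins 6 0 0 0 K v n σ

  step-cons : ∀ g gs K v → step n σ (pair (push (ins 7 g gs 0) K) v) ≡ pair (push g (push (ins 8 gs v 0) K)) v
  step-cons g gs K v = step-ins 7 g gs 0 K v n σ

  step-cons₁ : ∀ gs xs K y → step n σ (pair (push (ins 8 gs xs 0) K) y) ≡ pair (push gs (push (ins 9 y 0 0) K)) xs
  step-cons₁ gs xs K y = step-ins 8 gs xs 0 K y n σ

  step-cons₂ : ∀ y K ys → step n σ (pair (push (ins 9 y 0 0) K) ys) ≡ pair K (pair y ys)
  step-cons₂ y K ys = step-ins 9 y 0 0 K ys n σ

  step-precZ : ∀ g h K v → step n σ (pair (push (ins 10 g h 0) K) (pair 0 v)) ≡ pair (push g K) v
  step-precZ g h K v = trans (step-ins 10 g h 0 K _ n σ)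
    (helper (fst-pair 0 v) (snd-pair 0 v))
    where
    helper : ∀ {x y} → x ≡ 0 → y ≡ v → ifz x (pair (push g K) y)
      (pair (push (ins 10 g h 0) (push (ins 11 h (pred x) y) K)) (pair (pred x) y)) ≡ pair (push g K) v
    helper refl refl = refl

  step-precS : ∀ g h K k v → step n σ (pair (push (ins 10 g h 0) K) (pair (suc k) v)) ≡
    pair (push (ins 10 g h 0) (push (ins 11 h k v) K)) (pair k v)
  step-precS g h K k v = trans (step-ins 10 g h 0 K _ n σ)
    (helper (fst-pair (suc k) v) (snd-pair (suc k) v))
    where
    helper : ∀ {x y} → x ≡ suc k → y ≡ v → ifz x (pair (push g K) y)
      (pair (push (ins 10 g h 0) (push (ins 11 h (pred x) y) K)) (pair (pred x) y)) ≡
      pair (push (ins 10 g h 0) (push (ins 11 h k v) K)) (pair k v)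
    helper refl refl = refl

  step-prec₁ : ∀ h k v K r → step n σ (pair (push (ins 11 h k v) K) r) ≡ pair (push h K) (pair k (pair r v))
  step-prec₁ h k v K r = step-ins 11 h k v K r n σ

  step-mu : ∀ f K v → step n σ (pair (push (ins 12 f 0 0) K) v) ≡ pair (push f (push (ins 13 f 0 v) K)) (pair 0 v)
  step-mu f K v = step-ins 12 f 0 0 K v n σ

  step-mu-found : ∀ f z v K → step n σ (pair (push (ins 13 f z v) K) 0) ≡ pair K z
  step-mu-found f z v K = step-ins 13 f z v K 0 n σ

  step-mu-next : ∀ f z v K w → step n σ (pair (push (ins 13 f z v) K) (suc w)) ≡
    pair (push f (push (ins 13 f (suc z) v) K)) (pair (suc z) v)
  step-mu-next f z v K w = step-ins 13 f z v K (suc w) n σ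

encodeProj : ∀ {n} → Fin n → ℕ
encodeProj zero    = ins 3 0 0 0
encodeProj (suc i) = ins 4 (encodeProj i) 0 0

mutual
  encode : ∀ {O n} → Program O n → ℕ
  encode zero        = ins 0 0 0 0
  encode succ        = ins 1 0 0 0
  -- The name of the oracle is dropped, since all oracles are answered by the same string.
  encode (oracle _)  = ins 2 0 0 0
  encode (proj i)    = encodeProj i
  encode (comp f gs) = ins 5 (encode f) (encode* gs) 0
  encode (prec g h)  = ins 10 (encode g) (encode h) 0
  encode (mu f)      = ins 12 (encode f) 0 0

  encode* : ∀ {O n m} → Vec (Program O n) m → ℕ
  encode* []       = ins 6 0 0 0
  encode* (g ∷ gs) = ins 7 (encode g) (encode* gs) 0

tuple : ∀ {n} → Vec ℕ n → ℕ
tuple []       = 0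
tuple (x ∷ xs) = pair x (tuple xs)

call : ℕ → ℕ → ∀ {n} → Vec ℕ n → ℕ
call c K xs = pair (push c K) (tuple xs)

-- Completeness

-- This has the use principle built in: the same t steps work for every long enough finite part of
-- the oracle.
Reaches : {O : Set} → (O → ℕ → ℕ) → ℕ → ℕ → Set
Reaches F st st′ = ∃[ N ] ∃[ t ] (∀ s → Agree F s → N ≤ length s → iter (step (length s) (code s)) t st ≡ st′)

module _ {O : Set} {F : O → ℕ → ℕ} where

  infixr 5 _▷_ _then_

  _then_ : ∀ {st st′ st″} → Reaches F st st′ → Reaches F st′ st″ → Reaches F st st″
  (N , t , h) then (N′ , t′ , h′) = N ⊔ N′ , t′ + t , λ s ag le →
    trans (iter-+ _ t′ t _) (trans (cong (iter _ t′) (h s ag (≤-trans (m≤m⊔n N N′) le)))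
      (h′ s ag (≤-trans (m≤n⊔m N N′) le)))

  _▷_ : ∀ {st st′ st″} → (∀ {n} σ → step n σ st ≡ st′) → Reaches F st′ st″ → Reaches F st st″
  eq ▷ r = (0 , 1 , λ s _ _ → eq (code s)) then r

  done : ∀ {st} → Reaches F st st
  done = 0 , 0 , λ _ _ _ → refl

  complete-proj : ∀ {n} (i : Fin n) (xs : Vec ℕ n) K → Reaches F (call (encodeProj i) K xs) (pair K (lookup xs i))
  complete-proj zero    (x ∷ xs) K = (λ σ → step-proj0 σ K x (tuple xs)) ▷ done
  complete-proj (suc i) (x ∷ xs) K = (λ σ → step-projS σ (encodeProj i) K x (tuple xs)) ▷ complete-proj i xs K

  -- Induction on the number d of candidates left before y; the frame with tag 13 holds the
  -- candidate z under test.
  complete-mu : ∀ {n} f (xs : Vec ℕ n) y →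
    (∀ K → Reaches F (call f K (y ∷ xs)) (pair K 0)) →
    (∀ z → z < y → ∃[ w ] (∀ K → Reaches F (call f K (z ∷ xs)) (pair K (suc w)))) →
    ∀ d z → z + d ≡ y → ∀ K → Reaches F (call f (push (ins 13 f z (tuple xs)) K) (z ∷ xs)) (pair K y)
  complete-mu f xs y base below zero z eq K with refl ← trans (sym (+-identityʳ z)) eq =
    base _ then (λ σ → step-mu-found σ f y (tuple xs) K) ▷ done
  complete-mu f xs y base below (suc d) z eq K
    with w , r ← below z (subst (z <_) eq (m<m+n z (s≤s z≤n))) =
    r _ then (λ σ → step-mu-next σ f z (tuple xs) K w) ▷
      complete-mu f xs y base below d (suc z) (trans (sym (+-suc z d)) eq) K

  mutual
    -- The remaining stack K is arbitrary, so that runs of subprograms can be chained.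
    complete : ∀ {n} {e : Program O n} {xs y} → F ⊢ e [ xs ]⇓ y →
      ∀ K → Reaches F (call (encode e) K xs) (pair K y)
    complete zero⇓ K = (λ σ → step-zero σ K _) ▷ done
    complete (succ⇓ {x}) K = (λ σ → step-succ σ K x 0) ▷ done
    complete (oracle⇓ {o} {x}) K = suc x , 1 , λ s ag le →
      trans (step-oracle (code s) K x 0 le) (cong (pair K) (sym (ag o x le)))
    complete (proj⇓ {i = i} {xs}) K = complete-proj i xs K
    complete (comp⇓ {f = f} {gs} {xs} ps p) K =
      (λ σ → step-comp σ (encode f) (encode* gs) K (tuple xs)) ▷ complete* ps _ then complete p K
    complete (precZ⇓ {g = g} {h} {xs} p) K =
      (λ σ → step-precZ σ (encode g) (encode h) K (tuple xs)) ▷ complete p K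
    complete (precS⇓ {g = g} {h} {xs} {k} {r} p q) K =
      (λ σ → step-precS σ (encode g) (encode h) K k (tuple xs)) ▷ complete p _ then
      (λ σ → step-prec₁ σ (encode h) k (tuple xs) K r) ▷ complete q K
    complete (mu⇓ {f = f} {xs} {y} p below) K =
      (λ σ → step-mu σ (encode f) K (tuple xs)) ▷
        complete-mu (encode f) xs y (complete p)
          (λ z z<y → proj₁ (below z z<y) , complete (proj₂ (below z z<y))) y 0 refl K

    complete* : ∀ {n m} {gs : Vec (Program O n) m} {xs ys} → Pointwise (λ g y → F ⊢ g [ xs ]⇓ y) gs ys →
      ∀ K → Reaches F (call (encode* gs) K xs) (pair K (tuple ys))
    complete* [] K = (λ σ → step-nil σ K _) ▷ done
    complete* {gs = g ∷ gs} {xs} {y ∷ ys} (p ∷ ps) K =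
      (λ σ → step-cons σ (encode g) (encode* gs) K (tuple xs)) ▷ complete p _ then
      (λ σ → step-cons₁ σ (encode* gs) (tuple xs) K y) ▷ complete* ps _ then
      (λ σ → step-cons₂ σ y K (tuple ys)) ▷ done

-- Soundness

module _ {O : Set} {F : O → ℕ → ℕ} {s : String} (agree : Agree F s) where

  Halts : ℕ → ℕ → ℕ → Set
  Halts t st w = iter (step (length s) (code s)) t st ≡ pair 0 w

  push-running : ∀ {k K v w} → pair (push k K) v ≡ pair 0 w → ⊥
  push-running {k} {K} {v} {w} eq
    with () ← trans (sym (fst-pair (push k K) v)) (trans (cong fst eq) (fst-pair 0 w))

  halts-step : ∀ {t k K v st w} → step (length s) (code s) (pair (push k K) v) ≡ st →
    Halts t (pair (push k K) v) w → ∃[ t′ ] t′ < t × Halts t′ st w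
  halts-step {zero}  eq h = ⊥-elim (push-running h)
  halts-step {suc t} eq h = t , ≤-refl , trans (cong (iter _ t) (sym eq)) (trans (sym (iter-shift _ t _)) h)

  not-stuck : ∀ {t k K v w} → step (length s) (code s) (pair (push k K) v) ≡ pair (push k K) v →
    ¬ Halts t (pair (push k K) v) w
  not-stuck {t} eq h = push-running (trans (sym (iter-fixed _ t eq)) h)

  -- What a halting run that begins with a call must pass through. The strict decrease t′ < t is
  -- what makes the induction in `sound-mu` possible.
  Returns : ℕ → ∀ {n} → Program O n → Vec ℕ n → ℕ → ℕ → Set
  Returns t e xs K w = ∃[ y ] ∃[ t′ ] t′ < t × F ⊢ e [ xs ]⇓ y × Halts t′ (pair K y) w

  sound-proj : ∀ {n} (i : Fin n) xs {t K w} → Halts t (call (encodeProj i) K xs) w →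
    ∃[ t′ ] t′ < t × Halts t′ (pair K (lookup xs i)) w
  sound-proj zero    (x ∷ xs) h = halts-step (step-proj0 (code s) _ x (tuple xs)) h
  sound-proj (suc i) (x ∷ xs) h with t₁ , lt₁ , h₁ ← halts-step (step-projS (code s) _ _ x (tuple xs)) h
    with t₂ , lt₂ , h₂ ← sound-proj i xs h₁ = t₂ , <-trans lt₂ lt₁ , h₂

  below-suc : ∀ {P : ℕ → Set} {z} → (∀ x → x < z → P x) → P z → ∀ x → x < suc z → P x
  below-suc below p x x<sz with m≤n⇒m<n∨m≡n (s≤s⁻¹ x<sz)
  ... | inj₁ x<z  = below x x<z
  ... | inj₂ refl = p

  -- An unbounded search gives no structure to recurse on, so the induction is on a bound `fuel` for
  -- the running time, which drops with each failed candidate.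
  sound-mu : ∀ {n} (f : Program O (suc n)) xs
    (sound-f : ∀ z {t K w} → Halts t (call (encode f) K (z ∷ xs)) w → Returns t f (z ∷ xs) K w) →
    ∀ fuel z {t K w} → t ≤ fuel → (∀ z′ → z′ < z → ∃[ v ] F ⊢ f [ z′ ∷ xs ]⇓ suc v) →
    Halts t (call (encode f) (push (ins 13 (encode f) z (tuple xs)) K) (z ∷ xs)) w → Returns t (mu f) xs K w
  sound-mu f xs sound-f zero z z≤n below h = ⊥-elim (push-running h)
  sound-mu f xs sound-f (suc fuel) z le below h with sound-f z h
  ... | zero , t₁ , lt₁ , p , h₁ with t₂ , lt₂ , h₂ ← halts-step (step-mu-found (code s) _ z (tuple xs) _) h₁ =
    z , t₂ , <-trans lt₂ lt₁ , mu⇓ p below , h₂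
  ... | suc v , t₁ , lt₁ , p , h₁ with t₂ , lt₂ , h₂ ← halts-step (step-mu-next (code s) _ z (tuple xs) _ v) h₁
    with y , t₃ , lt₃ , q , h₃ ← sound-mu f xs sound-f fuel (suc z)
      (s≤s⁻¹ (≤-trans (<-trans lt₂ lt₁) le)) (below-suc below (v , p)) h₂ =
    y , t₃ , <-trans lt₃ (<-trans lt₂ lt₁) , q , h₃

  mutual
    sound : ∀ {n} (e : Program O n) xs {t K w} → Halts t (call (encode e) K xs) w → Returns t e xs K w
    sound zero [] h with t₁ , lt₁ , h₁ ← halts-step (step-zero (code s) _ _) h = 0 , t₁ , lt₁ , zero⇓ , h₁
    sound succ (x ∷ []) h with t₁ , lt₁ , h₁ ← halts-step (step-succ (code s) _ x 0) h =
      suc x , t₁ , lt₁ , succ⇓ , h₁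
    sound (oracle o) (x ∷ []) {t} h with x <? length s
    ... | no x≮n = ⊥-elim (not-stuck {t} (step-stuck (code s) _ x 0 x≮n) h)
    ... | yes x<n with t₁ , lt₁ , h₁ ← halts-step (step-oracle (code s) _ x 0 x<n) h =
      at s x , t₁ , lt₁ , subst (F ⊢ oracle o [ x ∷ [] ]⇓_) (agree o x x<n) oracle⇓ , h₁
    sound (proj i) xs h with t₁ , lt₁ , h₁ ← sound-proj i xs h = lookup xs i , t₁ , lt₁ , proj⇓ , h₁
    sound (comp f gs) xs h with t₁ , lt₁ , h₁ ← halts-step (step-comp (code s) _ _ _ _) h
      with ys , t₂ , lt₂ , ps , h₂ ← sound* gs xs h₁
      with y , t₃ , lt₃ , p , h₃ ← sound f ys h₂ =
      y , t₃ , <-trans lt₃ (<-trans lt₂ lt₁) , comp⇓ ps p , h₃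
    sound (prec g k) (x ∷ xs) h = sound-prec g k x xs h
    sound (mu f) xs h with t₁ , lt₁ , h₁ ← halts-step (step-mu (code s) _ _ _) h
      with y , t₂ , lt₂ , p , h₂ ← sound-mu f xs (λ z → sound f (z ∷ xs)) t₁ 0 ≤-refl (λ _ ()) h₁ =
      y , t₂ , <-trans lt₂ lt₁ , p , h₂

    sound-prec : ∀ {n} (g : Program O n) k x xs {t K w} → Halts t (call (encode (prec g k)) K (x ∷ xs)) w →
      Returns t (prec g k) (x ∷ xs) K w
    sound-prec g k zero xs h with t₁ , lt₁ , h₁ ← halts-step (step-precZ (code s) _ _ _ _) h
      with y , t₂ , lt₂ , p , h₂ ← sound g xs h₁ = y , t₂ , <-trans lt₂ lt₁ , precZ⇓ p , h₂
    sound-prec g k (suc x) xs h with t₁ , lt₁ , h₁ ← halts-step (step-precS (code s) _ _ _ x _) h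
      with r , t₂ , lt₂ , p , h₂ ← sound-prec g k x xs h₁
      with t₃ , lt₃ , h₃ ← halts-step (step-prec₁ (code s) _ x (tuple xs) _ r) h₂
      with y , t₄ , lt₄ , q , h₄ ← sound k (x ∷ r ∷ xs) h₃ =
      y , t₄ , <-trans lt₄ (<-trans lt₃ (<-trans lt₂ lt₁)) , precS⇓ p q , h₄

    sound* : ∀ {n m} (gs : Vec (Program O n) m) xs {t K w} → Halts t (call (encode* gs) K xs) w →
      Σ[ ys ∈ Vec ℕ m ] ∃[ t′ ] t′ < t × Pointwise (λ g y → F ⊢ g [ xs ]⇓ y) gs ys × Halts t′ (pair K (tuple ys)) w
    sound* [] xs h with t₁ , lt₁ , h₁ ← halts-step (step-nil (code s) _ _) h = [] , t₁ , lt₁ , [] , h₁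
    sound* (g ∷ gs) xs h with t₁ , lt₁ , h₁ ← halts-step (step-cons (code s) _ _ _ _) h
      with y , t₂ , lt₂ , p , h₂ ← sound g xs h₁
      with t₃ , lt₃ , h₃ ← halts-step (step-cons₁ (code s) _ _ _ y) h₂
      with ys , t₄ , lt₄ , ps , h₄ ← sound* gs xs h₃
      with t₅ , lt₅ , h₅ ← halts-step (step-cons₂ (code s) y _ (tuple ys)) h₄ =
      y ∷ ys , t₅ , <-trans lt₅ (<-trans lt₄ (<-trans lt₃ (<-trans lt₂ lt₁))) , p ∷ ps , h₅

-- Time-bounded evaluation with a finite oracle

result : ℕ → ℕ → ℕ → ℕ → ℕ
result p m n σ = iter (step n σ) n (pair (push p 0) (pair m 0))

resultFn : Fn 4
resultFn = retarget
  (app (iterFn (app (retarget stepFn (λ { (st ∷ n ∷ σ ∷ []) → step n σ st })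
                     λ { (st ∷ n ∷ σ ∷ []) → step-correct st n σ })
                  (var v0 ∷ var v1 ∷ var v2 ∷ [])))
    (var v2 ∷ pairFn (pushFn (var v0) zeroFn) (pairFn (var v1) zeroFn) ∷ var v2 ∷ var v3 ∷ []))
  (λ { (p ∷ m ∷ n ∷ σ ∷ []) → result p m n σ })
  λ { (p ∷ m ∷ n ∷ σ ∷ []) → refl }

-- Program p halts on m with output v within length s steps, reading only the oracle values listed in s.
Outputs : ℕ → ℕ → ℕ → String → Set
Outputs p m v s = result p m (length s) (code s) ≡ pair 0 v

halted-mono : ∀ {n σ t t′ st w} → t ≤ t′ → iter (step n σ) t st ≡ pair 0 w → iter (step n σ) t′ st ≡ pair 0 w
halted-mono {n} {σ} {t} {t′} {st} {w} t≤t′ h = begin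
  iter (step n σ) t′ st                          ≡⟨ cong (λ k → iter (step n σ) k st) (sym (m∸n+n≡m t≤t′)) ⟩
  iter (step n σ) (t′ ∸ t + t) st                ≡⟨ iter-+ _ (t′ ∸ t) t st ⟩
  iter (step n σ) (t′ ∸ t) (iter (step n σ) t st) ≡⟨ cong (iter (step n σ) (t′ ∸ t)) h ⟩
  iter (step n σ) (t′ ∸ t) (pair 0 w)            ≡⟨ iter-fixed _ (t′ ∸ t) (step-halted n σ w) ⟩
  pair 0 w ∎
  where open ≡-Reasoning

⇓⇒Outputs : ∀ {O} {F : O → ℕ → ℕ} {e m v} → F ⊢ e [ m ∷ [] ]⇓ v →
  ∃[ N ] (∀ s → Agree F s → N ≤ length s → Outputs (encode e) m v s)
⇓⇒Outputs p with N , t , h ← complete p 0 =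
  N ⊔ t , λ s ag le → halted-mono (≤-trans (m≤n⊔m N t) le) (h s ag (≤-trans (m≤m⊔n N t) le))

Outputs⇒⇓ : ∀ {O} {F : O → ℕ → ℕ} {e m v s} → Agree F s → Outputs (encode e) m v s → F ⊢ e [ m ∷ [] ]⇓ v
Outputs⇒⇓ {F = F} {e} {m} {v} {s} ag h with y , t , _ , p , h′ ← sound {s = s} ag e (m ∷ []) {length s} {0} h =
  subst (F ⊢ e [ m ∷ [] ]⇓_) y≡v p
  where
  y≡v : y ≡ v
  -- The rest of the run starts in the halted state with value y and never leaves it, yet ends with
  -- value v.
  y≡v = trans (sym (snd-pair 0 y)) (trans
    (cong snd (trans (sym (iter-fixed _ t (step-halted (length s) (code s) y))) h′)) (snd-pair 0 v))

-- A linearly universal partial recursive function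

-- A program without oracles agrees with every string, so a string of zeros can serve as a mere
-- clock.
zeros : ℕ → ℕ
zeros n = code (replicate n 0)

zerosFn : Fn 1
zerosFn = fn₁ (recur zeroFn (pairFn (var v1) zeroFn)) zeros (natrec-cong zeros refl λ _ → refl)

universalResultFn : Fn 2
universalResultFn = app resultFn
  (fstFn (var v1) ∷ sndFn (var v1) ∷ var v0 ∷ app zerosFn (var v0 ∷ []) ∷ [])

-- Zero exactly when the state reached has the halted form `pair 0 w`.
haltedFn : Fn 2
haltedFn = distFn universalResultFn (pairFn zeroFn (sndFn universalResultFn))

opaque
  universal : Program ⊥ 1
  universal = search haltedFn (sndFn universalResultFn)

  universal⇓ : ∀ z n → fun haltedFn (n ∷ z ∷ []) ≡ 0 →
    ∃[ n₀ ] fun haltedFn (n₀ ∷ z ∷ []) ≡ 0 ×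
      noOracle ⊢ universal [ z ∷ [] ]⇓ snd (fun universalResultFn (n₀ ∷ z ∷ []))
  universal⇓ z n = search⇓ haltedFn (sndFn universalResultFn) (z ∷ []) n

  universal⇓⁻¹ : ∀ z {w} → noOracle ⊢ universal [ z ∷ [] ]⇓ w →
    ∃[ n ] fun haltedFn (n ∷ z ∷ []) ≡ 0 × w ≡ snd (fun universalResultFn (n ∷ z ∷ []))
  universal⇓⁻¹ z = search⇓⁻¹ haltedFn (sndFn universalResultFn) (z ∷ [])

Universal : Rel ℕ 0ℓ
Universal z y = noOracle ⊢ universal [ z ∷ [] ]⇓ y

universalResult : ∀ (e : Program ⊥ 1) x n → fun universalResultFn (n ∷ pair (encode e) x ∷ []) ≡
  result (encode e) x (length (replicate n 0)) (code (replicate n 0))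
universalResult e x n rewrite fst-pair (encode e) x | snd-pair (encode e) x | length-replicate n {0} = refl

Universal⇒⇓ : ∀ (e : Program ⊥ 1) x y → Universal (pair (encode e) x) y → noOracle ⊢ e [ x ∷ [] ]⇓ y
Universal⇒⇓ e x y u with n , stop , refl ← universal⇓⁻¹ _ u =
  Outputs⇒⇓ {e = e} {s = replicate n 0} (λ ())
    (trans (sym (universalResult e x n)) (dist≡0⇒≡ _ _ stop))

outputs⇒universalResult : ∀ (e : Program ⊥ 1) x y N →
  (∀ s → Agree noOracle s → N ≤ length s → Outputs (encode e) x y s) →
  fun universalResultFn (N ∷ pair (encode e) x ∷ []) ≡ pair 0 y
outputs⇒universalResult e x y N h = trans (universalResult e x N)
  (h (replicate N 0) (λ ()) (≤-reflexive (sym (length-replicate N))))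

⇓⇒Universal : ∀ (e : Program ⊥ 1) x y → noOracle ⊢ e [ x ∷ [] ]⇓ y → Universal (pair (encode e) x) y
⇓⇒Universal e x y p with N , h ← ⇓⇒Outputs p
  with n , stop , u ← universal⇓ (pair (encode e) x) N
    (trans (cong (λ r → dist r (pair 0 (snd r))) (outputs⇒universalResult e x y N h))
      (trans (cong (λ w → dist (pair 0 y) (pair 0 w)) (snd-pair 0 y)) (dist-refl (pair 0 y)))) =
  -- The search may stop at a time other than N, but soundness and determinism show that it still
  -- returns y.
  subst (Universal (pair (encode e) x)) (deterministic (Universal⇒⇓ e x _ u) p) u

-- For fixed e the code `pair (encode e) x` is a linear function of x by `pair-linear`.
Universal-linear : LinearlyUniversal Universal
Universal-linear θ (e , h) = 2 ^ suc (encode e) , 2 ^ encode e , λ x y → mk⇔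
  (λ u → Equivalence.from (h x y) (Universal⇒⇓ e x y (subst (λ z → Universal z y) (sym (pair-linear (encode e) x)) u)))
  (λ t → subst (λ z → Universal z y) (pair-linear (encode e) x) (⇓⇒Universal e x y (Equivalence.to (h x y) t)))

-- Big sets of strings

-- A set of numbers is given by the places where c is positive; this is its cardinality below a
-- bound.
count : (ℕ → ℕ) → ℕ → ℕ
count c = sum (sgn ∘ c)

count>0 : ∀ c n → 1 ≤ count c n → ∃[ i ] i < n × 0 < c i
count>0 c (suc n) le with c n in eq
... | suc k = n , ≤-refl , subst (0 <_) (sym eq) (s≤s z≤n)
... | zero with i , i<n , ci ← count>0 c n le = i , m≤n⇒m≤1+n i<n , ci

count>1 : ∀ c n → 2 ≤ count c n → ∃[ i ] ∃[ j ] i < j × j < n × 0 < c i × 0 < c j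
count>1 c (suc n) le with c n in eq
... | suc k with i , i<n , ci ← count>0 c n (s≤s⁻¹ le) =
  i , n , i<n , ≤-refl , ci , subst (0 <_) (sym eq) (s≤s z≤n)
... | zero with i , j , i<j , j<n , ci , cj ← count>1 c n le = i , j , i<j , m≤n⇒m≤1+n j<n , ci , cj

count-all : ∀ n → count (λ _ → 1) n ≡ n
count-all zero    = refl
count-all (suc n) = cong suc (count-all n)

-- Each chosen i is put into just one of the two parts, even if both properties hold, so the
-- cardinalities add up exactly.
count-split : ∀ {P Q : ℕ → Set} (c : ℕ → ℕ) n → (∀ i → i < n → 0 < c i → P i ⊎ Q i) →
  ∃[ c₁ ] ∃[ c₂ ] count c n ≡ count c₁ n + count c₂ n ×
    (∀ i → i < n → 0 < c₁ i → P i) × (∀ i → i < n → 0 < c₂ i → Q i)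
count-split c zero    h = c , c , refl , (λ _ ()) , (λ _ ())
count-split {P} {Q} c (suc n) h with c₁ , c₂ , eq , p , q ← count-split c n (λ i i<n → h i (m≤n⇒m≤1+n i<n)) =
  add (c n) refl
  where
  set : (ℕ → ℕ) → ℕ → ℕ → ℕ
  set d x i with i ≟ n
  ... | yes _ = x
  ... | no  _ = d i
  set-n : ∀ d x → set d x n ≡ x
  set-n d x with n ≟ n
  ... | yes _  = refl
  ... | no n≢n = contradiction refl n≢n
  set-< : ∀ d x i → i < n → set d x i ≡ d i
  set-< d x i i<n with i ≟ n
  ... | yes refl = contradiction i<n (<-irrefl refl)
  ... | no  _    = refl
  count-set : ∀ d x → count (set d x) (suc n) ≡ sgn x + count d n
  count-set d x = cong₂ _+_ (cong sgn (set-n d x)) (sum-cong n λ i i<n → cong sgn (set-< d x i i<n))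
  set-all : ∀ {R : ℕ → Set} d x → (∀ i → i < n → 0 < d i → R i) → (0 < x → R n) →
    ∀ i → i < suc n → 0 < set d x i → R i
  set-all d x r rn i i<sn pos with i ≟ n
  ... | yes refl = rn pos
  ... | no i≢n   = r i (≤∧≢⇒< (s≤s⁻¹ i<sn) i≢n) pos
  build : ∀ x₁ x₂ → sgn (c n) ≡ sgn x₁ + sgn x₂ → (0 < x₁ → P n) → (0 < x₂ → Q n) →
    ∃[ c₁ ] ∃[ c₂ ] count c (suc n) ≡ count c₁ (suc n) + count c₂ (suc n) ×
      (∀ i → i < suc n → 0 < c₁ i → P i) × (∀ i → i < suc n → 0 < c₂ i → Q i)
  build x₁ x₂ eqn p′ q′ = set c₁ x₁ , set c₂ x₂ ,
    (begin
      sgn (c n) + count c n                                  ≡⟨ cong₂ _+_ eqn eq ⟩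
      (sgn x₁ + sgn x₂) + (count c₁ n + count c₂ n)          ≡⟨ +-assoc (sgn x₁) _ _ ⟩
      sgn x₁ + (sgn x₂ + (count c₁ n + count c₂ n))          ≡⟨ cong (sgn x₁ +_) (sym (+-assoc (sgn x₂) _ _)) ⟩
      sgn x₁ + ((sgn x₂ + count c₁ n) + count c₂ n)          ≡⟨ cong (λ z → sgn x₁ + (z + count c₂ n)) (+-comm (sgn x₂) _) ⟩
      sgn x₁ + ((count c₁ n + sgn x₂) + count c₂ n)          ≡⟨ cong (sgn x₁ +_) (+-assoc (count c₁ n) _ _) ⟩
      sgn x₁ + (count c₁ n + (sgn x₂ + count c₂ n))          ≡⟨ sym (+-assoc (sgn x₁) _ _) ⟩
      (sgn x₁ + count c₁ n) + (sgn x₂ + count c₂ n)          ≡⟨ sym (cong₂ _+_ (count-set c₁ x₁) (count-set c₂ x₂)) ⟩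
      count (set c₁ x₁) (suc n) + count (set c₂ x₂) (suc n)  ∎) ,
    set-all c₁ x₁ p p′ , set-all c₂ x₂ q q′
    where open ≡-Reasoning
  add : ∀ x → c n ≡ x → ∃[ c₁ ] ∃[ c₂ ] count c (suc n) ≡ count c₁ (suc n) + count c₂ (suc n) ×
      (∀ i → i < suc n → 0 < c₁ i → P i) × (∀ i → i < suc n → 0 < c₂ i → Q i)
  add zero eq′ = build 0 0 (cong sgn eq′) (λ ()) (λ ())
  add (suc x) eq′ with h n ≤-refl (subst (0 <_) (sym eq′) (s≤s z≤n))
  ... | inj₁ pn = build 1 0 (cong sgn eq′) (λ _ → pn) (λ ())
  ... | inj₂ qn = build 0 1 (cong sgn eq′) (λ ()) (λ _ → qn)

module Trees (g : ℕ → ℕ) where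

  infix 4 _⊑_

  -- Only the added entries are bounded by g; hence `[] ⊑ s` says that all entries of s are.
  data _⊑_ (s : String) : String → Set where
    ⊑-refl : s ⊑ s
    ⊑-∷    : ∀ {i τ} → s ⊑ τ → i < g (length τ) → s ⊑ i ∷ τ

  ⊑-trans : ∀ {s τ υ} → s ⊑ τ → τ ⊑ υ → s ⊑ υ
  ⊑-trans p ⊑-refl      = p
  ⊑-trans p (⊑-∷ q i<g) = ⊑-∷ (⊑-trans p q) i<g

  ⊑-length : ∀ {s τ} → s ⊑ τ → length s ≤ length τ
  ⊑-length ⊑-refl    = ≤-refl
  ⊑-length (⊑-∷ p _) = m≤n⇒m≤1+n (⊑-length p)

  ⊑-at : ∀ {s τ k} → s ⊑ τ → k < length s → at τ k ≡ at s k
  ⊑-at ⊑-refl k<n = refl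
  ⊑-at (⊑-∷ {i} {τ} p _) k<n = trans (at-∷ i τ (≤-trans k<n (⊑-length p))) (⊑-at p k<n)

  ⊑-at-< : ∀ {s k} → [] ⊑ s → k < length s → at s k < g k
  ⊑-at-< {s} {k} (⊑-∷ {i} {τ} p i<g) k<n with m≤n⇒m<n∨m≡n (s≤s⁻¹ k<n)
  ... | inj₁ k<m  = subst (_< g k) (sym (at-∷ i τ k<m)) (⊑-at-< p k<m)
  ... | inj₂ refl = subst (_< g (length τ)) (sym (at-last i τ)) i<g

  -- The usual notion of a set that is H-big above s: some finite tree with stem s has its leaves in
  -- P and at least H children at every other node. The children are the i with c i positive.
  data Big (H : ℕ) (P : String → Set) : String → Set where
    leaf : ∀ {s} → P s → Big H P s
    node : ∀ {s} (c : ℕ → ℕ) → H ≤ count c (g (length s)) →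
           (∀ i → i < g (length s) → 0 < c i → Big H P (i ∷ s)) → Big H P s

  -- The concatenation property: trees are grafted onto the leaves of a tree.
  Big-bind : ∀ {H P Q s} → Big H P s → (∀ τ → s ⊑ τ → P τ → Big H Q τ) → Big H Q s
  Big-bind (leaf p) f = f _ ⊑-refl p
  Big-bind (node c le h) f = node c le λ i i<g pos →
    Big-bind (h i i<g pos) λ τ i∷s⊑τ → f τ (⊑-trans (⊑-∷ ⊑-refl i<g) i∷s⊑τ)

  Big-map : ∀ {H P Q s} → (∀ τ → P τ → Q τ) → Big H P s → Big H Q s
  Big-map f b = Big-bind b λ τ _ p → leaf (f τ p)

  -- By induction every chosen child is H-big for P or H′-big for Q; with fewer than H of the first
  -- kind and fewer than H′ of the second there would be fewer than H + H′ children.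
  Big-⊎ : ∀ {H H′ P Q s} → Big (H + H′) (λ τ → P τ ⊎ Q τ) s → Big H P s ⊎ Big H′ Q s
  Big-⊎ (leaf (inj₁ p)) = inj₁ (leaf p)
  Big-⊎ (leaf (inj₂ q)) = inj₂ (leaf q)
  Big-⊎ {H} {H′} {P} {Q} {s} (node c le h)
    with c₁ , c₂ , eq , p , q ← count-split {λ i → Big H P (i ∷ s)} {λ i → Big H′ Q (i ∷ s)}
           c (g (length s)) (λ i i<g pos → Big-⊎ (h i i<g pos))
    with H ≤? count c₁ (g (length s)) | H′ ≤? count c₂ (g (length s))
  ... | yes le₁ | _       = inj₁ (node c₁ le₁ p)
  ... | no _    | yes le₂ = inj₂ (node c₂ le₂ q)
  ... | no nle₁ | no nle₂ = contradiction (subst (H + H′ ≤_) eq le) (<⇒≱ (+-mono-< (≰⇒> nle₁) (≰⇒> nle₂)))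

  -- Splits off one set `A n` at a time by `Big-⊎`. This is the price of avoiding all outputs below
  -- a bound n.
  Big-⋃ : ∀ {H₀ H} {B : String → Set} {A : ℕ → String → Set} {s} → ¬ Big H₀ B s →
    (∀ v → ¬ Big H (A v) s) → ∀ n → ¬ Big (H₀ + n * H) (λ τ → B τ ⊎ (∃[ v ] v < n × A v τ)) s
  Big-⋃ {H₀} {H} {B} {A} {s} ¬B ¬A zero b = ¬B
    (subst (λ H → Big H B s) (+-identityʳ H₀) (Big-map (λ { τ (inj₁ p) → p ; τ (inj₂ (_ , () , _)) }) b))
  Big-⋃ {H₀} {H} {B} {A} {s} ¬B ¬A (suc n) b =
    [ ¬A n , Big-⋃ ¬B ¬A n ]′ (Big-⊎ (subst (λ H → Big H split-set s) assoc (Big-map split b)))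
    where
    assoc : H₀ + suc n * H ≡ H + (H₀ + n * H)
    assoc = trans (sym (+-assoc H₀ H _)) (trans (cong (_+ n * H) (+-comm H₀ H)) (+-assoc H H₀ _))
    split-set : String → Set
    split-set τ = A n τ ⊎ (B τ ⊎ (∃[ v ] v < n × A v τ))
    split : ∀ τ → B τ ⊎ (∃[ v ] v < suc n × A v τ) → split-set τ
    split τ (inj₁ p) = inj₂ (inj₁ p)
    split τ (inj₂ (v , v<sn , a)) with m≤n⇒m<n∨m≡n (s≤s⁻¹ v<sn)
    ... | inj₁ v<n  = inj₂ (inj₂ (v , v<n , a))
    ... | inj₂ refl = inj₁ a

  Hits : (ℕ → ℕ → Set) → String → Set
  Hits R s = ∃[ k ] k < length s × R k (at s k)

  -- Two distinct children of s both hit R. If neither hit occurs within s, then R takes two values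
  -- at `length s`, against uniqueness.
  Big-Hits : ∀ {R} → (∀ {k y z} → R k y → R k z → y ≡ z) → ∀ {s} → Big 2 (Hits R) s → Hits R s
  Big-Hits unique (leaf p) = p
  Big-Hits {R} unique {s} (node c le h) with i , j , i<j , j<g , ci , cj ← count>1 c (g (length s)) le
    with earlier i (Big-Hits unique (h i (<-trans i<j j<g) ci)) | earlier j (Big-Hits unique (h j j<g cj))
    where
    earlier : ∀ i → Hits R (i ∷ s) → Hits R s ⊎ R (length s) i
    earlier i (k , k<n , r) with m≤n⇒m<n∨m≡n (s≤s⁻¹ k<n)
    ... | inj₁ k<m  = inj₁ (k , k<m , subst (R k) (at-∷ i s k<m) r)
    ... | inj₂ refl = inj₂ (subst (R k) (at-last i s) r)
  ... | inj₁ p  | _       = p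
  ... | inj₂ _  | inj₁ p  = p
  ... | inj₂ ri | inj₂ rj = contradiction (unique ri rj) (<⇒≢ i<j)

  module _ (em : ExcludedMiddle 0ℓ) where

    -- Otherwise all children would be big, and taking all of them would make s big. Excluded middle
    -- is used because bigness is not decidable in general.
    ¬Big-child : ∀ {H P s} → ¬ Big H P s → H ≤ g (length s) → ∃[ i ] i < g (length s) × ¬ Big H P (i ∷ s)
    ¬Big-child {H} {P} {s} ¬b le with em {∃[ i ] i < g (length s) × ¬ Big H P (i ∷ s)}
    ... | yes p = p
    ... | no ¬p = contradiction (node (λ _ → 1) (subst (H ≤_) (sym (count-all _)) le) children) ¬b
      where
      children : ∀ i → i < g (length s) → 0 < 1 → Big H P (i ∷ s)
      children i i<g _ with em {Big H P (i ∷ s)}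
      ... | yes b  = b
      ... | no ¬b′ = contradiction (i , i<g , ¬b′) ¬p

    ¬Big-extend : ∀ {H P s} → ¬ Big H P s → (∀ n → length s ≤ n → H ≤ g n) → ∀ d →
      ∃[ τ ] s ⊑ τ × length τ ≡ d + length s × ¬ Big H P τ
    ¬Big-extend {s = s} ¬b le zero = s , ⊑-refl , refl , ¬b
    ¬Big-extend ¬b le (suc d) with τ , s⊑τ , len , ¬b′ ← ¬Big-extend ¬b le d
      with i , i<g , ¬b″ ← ¬Big-child ¬b′ (le _ (⊑-length s⊑τ)) =
      i ∷ τ , ⊑-∷ s⊑τ i<g , cong suc len , ¬b″

    -- Otherwise P would be big above every leaf of the tree for Q, and grafting would make it big
    -- above s.
    ¬Big-meet : ∀ {H P Q s} → ¬ Big H P s → Big H Q s → ∃[ τ ] s ⊑ τ × Q τ × ¬ Big H P τ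
    ¬Big-meet {H} {P} {Q} {s} ¬b b with em {∃[ τ ] s ⊑ τ × Q τ × ¬ Big H P τ}
    ... | yes p = p
    ... | no ¬p = contradiction (Big-bind b big) ¬b
      where
      big : ∀ τ → s ⊑ τ → Q τ → Big H P τ
      big τ s⊑τ q with em {Big H P τ}
      ... | yes b′ = b′
      ... | no ¬b′ = contradiction (τ , s⊑τ , q , ¬b′) ¬p

sgn-mono : ∀ {x y} → (0 < x → 0 < y) → sgn x ≤ sgn y
sgn-mono {zero}          _ = z≤n
sgn-mono {suc _} {zero}  h with () ← h (s≤s z≤n)
sgn-mono {suc _} {suc _} _ = ≤-refl

count-mono : ∀ {c d} n → (∀ i → i < n → 0 < c i → 0 < d i) → count c n ≤ count d n
count-mono zero    h = z≤n
count-mono (suc n) h = +-mono-≤ (sgn-mono (h n ≤-refl)) (count-mono n λ i i<n → h i (m≤n⇒m≤1+n i<n))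

both? : ∀ {B : Set} → B → ∀ x → (B × 0 < x) ⊎ ¬ (B × 0 < x)
both? b zero    = inj₂ λ ()
both? b (suc x) = inj₁ (b , s≤s z≤n)

m+n>0 : ∀ m {n} → 0 < m + n → 0 < m ⊎ 0 < n
m+n>0 zero    p = inj₂ p
m+n>0 (suc m) _ = inj₁ (s≤s z≤n)

-- Certificates of bigness

node-code : String → ℕ
node-code s = pair (length s) (code s)

child : ℕ → ℕ → ℕ
child e i = pair (suc (fst e)) (pair (snd e) i)

child-node-code : ∀ s i → child (node-code s) i ≡ node-code (i ∷ s)
child-node-code s i = cong₂ (λ n c → pair (suc n) (pair c i)) (fst-pair _ _) (snd-pair _ _)

-- The ℓ entries fst (snd^j D), j < ℓ, of a certificate are codes of strings; each of
-- them has to lie in the set a ≡ 0 or to have H children among the later entries.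
member : ℕ → ℕ → ℕ → ℕ
member e ℓ D = sum (λ j → 1 ∸ dist e (fst (iter snd j D))) ℓ

member-suc : ∀ e ℓ D → member e (suc ℓ) D ≡ (1 ∸ dist e (fst D)) + member e ℓ (snd D)
member-suc e ℓ D = trans (sum-shift (λ j → 1 ∸ dist e (fst (iter snd j D))) ℓ)
  (cong ((1 ∸ dist e (fst D)) +_)
    (sum-cong ℓ λ j _ → cong (λ z → 1 ∸ dist e (fst z)) (iter-shift snd j D)))

list : List ℕ → ℕ
list []      = 0
list (e ∷ L) = pair e (list L)

member-∷ : ∀ e x L → member e (suc (length L)) (list (x ∷ L)) ≡ (1 ∸ dist e x) + member e (length L) (list L)
member-∷ e x L = trans (member-suc e (length L) (list (x ∷ L)))
  (cong₂ (λ y D → (1 ∸ dist e y) + member e (length L) D) (fst-pair _ _) (snd-pair _ _))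

member-++ : ∀ e L M → member e (length (L ++ M)) (list (L ++ M)) ≡
  member e (length L) (list L) + member e (length M) (list M)
member-++ e []      M = refl
member-++ e (x ∷ L) M = begin
  member e (suc (length (L ++ M))) (list (x ∷ L ++ M))           ≡⟨ member-∷ e x (L ++ M) ⟩
  (1 ∸ dist e x) + member e (length (L ++ M)) (list (L ++ M))    ≡⟨ cong ((1 ∸ dist e x) +_) (member-++ e L M) ⟩
  (1 ∸ dist e x) + (member e (length L) (list L) + member e (length M) (list M))
                                                                 ≡⟨ sym (+-assoc (1 ∸ dist e x) _ _) ⟩
  ((1 ∸ dist e x) + member e (length L) (list L)) + member e (length M) (list M)
    ≡⟨ cong (_+ member e (length M) (list M)) (sym (member-∷ e x L)) ⟩
  member e (suc (length L)) (list (x ∷ L)) + member e (length M) (list M) ∎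
  where open ≡-Reasoning

member-head : ∀ e L → 0 < member e (suc (length L)) (list (e ∷ L))
member-head e L rewrite member-∷ e e L | dist-refl e = s≤s z≤n

module Certificates (g : ℕ → ℕ) (a : ℕ → ℕ) (H : ℕ) where

  open Trees g

  InA : String → Set
  InA s = a (node-code s) ≡ 0

  -- A product of two defects: it vanishes if and only if e lies in the set or at least H of its
  -- children are listed.
  bad : ℕ → ℕ → ℕ → ℕ
  bad e ℓ D = a e * (H ∸ count (λ i → member (child e i) ℓ D) (g (fst e)))

  invalid : ℕ → ℕ → ℕ
  invalid ℓ D = sum (λ j → bad (fst (iter snd j D)) (ℓ ∸ suc j) (snd (iter snd j D))) ℓ

  invalid-suc : ∀ ℓ D → invalid (suc ℓ) D ≡ bad (fst D) ℓ (snd D) + invalid ℓ (snd D)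
  invalid-suc ℓ D = trans (sum-shift (λ j → bad (fst (iter snd j D)) (suc ℓ ∸ suc j) (snd (iter snd j D))) ℓ)
    (cong (bad (fst D) ℓ (snd D) +_)
      (sum-cong ℓ λ j _ → cong (λ z → bad (fst z) (ℓ ∸ suc j) (snd z)) (iter-shift snd j D)))

  -- Children are looked up among the later entries only, so induction on the length of the list
  -- rebuilds the tree.
  certified : ∀ ℓ D → invalid ℓ D ≡ 0 → ∀ s → 0 < member (node-code s) ℓ D → Big H InA s
  certified (suc ℓ) D valid s mem
    with m+n>0 (1 ∸ dist (node-code s) (fst D)) (subst (0 <_) (member-suc (node-code s) ℓ D) mem)
  ... | inj₂ later = certified ℓ (snd D) (m+n≡0⇒n≡0 (bad (fst D) ℓ (snd D)) (trans (sym (invalid-suc ℓ D)) valid)) s later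
  ... | inj₁ now with m*n≡0⇒m≡0∨n≡0 (a (node-code s)) bad≡0
    where
    positive⇒≡ : ∀ x y → 0 < 1 ∸ dist x y → x ≡ y
    positive⇒≡ x y lt with dist x y in eq
    ... | zero = dist≡0⇒≡ x y eq
    ... | suc k = contradiction (subst (0 <_) (0∸n≡0 k) lt) (λ ())
    bad≡0 : bad (node-code s) ℓ (snd D) ≡ 0
    bad≡0 = trans (cong (λ e → bad e ℓ (snd D)) (positive⇒≡ (node-code s) (fst D) now))
      (m+n≡0⇒m≡0 _ (trans (sym (invalid-suc ℓ D)) valid))
  ...   | inj₁ inA = leaf inA
  ...   | inj₂ few = node (λ i → member (child (node-code s) i) ℓ (snd D))
    (subst (λ n → H ≤ count (λ i → member (child (node-code s) i) ℓ (snd D)) (g n)) (fst-pair _ _) (m∸n≡0⇒m≤n few))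
    λ i _ pos → certified ℓ (snd D) (m+n≡0⇒n≡0 (bad (fst D) ℓ (snd D)) (trans (sym (invalid-suc ℓ D)) valid)) (i ∷ s)
      (subst (λ e → 0 < member e ℓ (snd D)) (child-node-code s i) pos)

  Valid : List ℕ → Set
  Valid L = invalid (length L) (list L) ≡ 0

  invalid-∷ : ∀ e L → invalid (suc (length L)) (list (e ∷ L)) ≡ bad e (length L) (list L) + invalid (length L) (list L)
  invalid-∷ e L = trans (invalid-suc (length L) (list (e ∷ L)))
    (cong₂ (λ y D → bad y (length L) D + invalid (length L) D) (fst-pair _ _) (snd-pair _ _))

  Valid-∷ : ∀ {e L} → bad e (length L) (list L) ≡ 0 → Valid L → Valid (e ∷ L)
  Valid-∷ {e} {L} p q = trans (invalid-∷ e L) (cong₂ _+_ p q)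

  -- Appending entries can only add listed children to the earlier ones.
  Valid-++ : ∀ L {M} → Valid L → Valid M → Valid (L ++ M)
  Valid-++ []      p q = q
  Valid-++ (e ∷ L) {M} p q = Valid-∷ {e} {L ++ M}
    (n≤0⇒n≡0 (subst (bad e (length (L ++ M)) (list (L ++ M)) ≤_) (m+n≡0⇒m≡0 _ split)
      (*-monoʳ-≤ (a e) (∸-monoʳ-≤ H (count-mono (g (fst e)) λ i _ pos →
        ≤-trans pos (≤-trans (m≤m+n _ _) (≤-reflexive (sym (member-++ (child e i) L M)))))))))
    (Valid-++ L (m+n≡0⇒n≡0 (bad e (length L) (list L)) split) q)
    where
    split : bad e (length L) (list L) + invalid (length L) (list L) ≡ 0
    split = trans (sym (invalid-∷ e L)) p

  Contains : List ℕ → String → Set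
  Contains L s = 0 < member (node-code s) (length L) (list L)

  collect : ∀ {P : ℕ → Set} {f : ℕ → String} → (∀ i → P i → ∃[ L ] Valid L × Contains L (f i)) →
    ∀ n → (∀ i → i < n → P i ⊎ ¬ P i) → ∃[ L ] Valid L × (∀ i → i < n → P i → Contains L (f i))
  collect h zero    dec = [] , refl , λ _ ()
  collect {P} {f} h (suc n) dec
    with M , vM , cM ← collect {P} {f} h n (λ i i<n → dec i (m≤n⇒m≤1+n i<n)) | dec n ≤-refl
  ... | inj₂ ¬Pn = M , vM , below
    where
    below : ∀ i → i < suc n → P i → Contains M (f i)
    below i i<sn Pi with m≤n⇒m<n∨m≡n (s≤s⁻¹ i<sn)
    ... | inj₁ i<n  = cM i i<n Pi
    ... | inj₂ refl = contradiction Pi ¬Pn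
  ... | inj₁ Pn with L , vL , cL ← h n Pn = L ++ M , Valid-++ L vL vM , below
    where
    below : ∀ i → i < suc n → P i → Contains (L ++ M) (f i)
    below i i<sn Pi rewrite member-++ (node-code (f i)) L M with m≤n⇒m<n∨m≡n (s≤s⁻¹ i<sn)
    ... | inj₁ i<n  = ≤-trans (cM i i<n Pi) (m≤n+m _ _)
    ... | inj₂ refl = ≤-trans cL (m≤m+n _ _)

  -- The certificates of the chosen children are concatenated and s is put in front, so that its
  -- children come later.
  certificate : ∀ {s} → Big H InA s → ∃[ L ] Valid L × Contains L s
  certificate {s} (leaf inA) = node-code s ∷ [] ,
    Valid-∷ {node-code s} {[]} (cong (_* (H ∸ count (λ i → 0) (g (fst (node-code s))))) inA) refl ,
    member-head (node-code s) []
  certificate {s} (node c le h)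
    with L , vL , cL ← collect {λ i → i < g (length s) × 0 < c i} {_∷ s} (λ i (i<g , pos) → certificate (h i i<g pos))
           (g (length s)) (λ i i<g → both? i<g (c i)) =
    node-code s ∷ L , Valid-∷ {node-code s} {L} enough vL , member-head (node-code s) L
    where
    enough : bad (node-code s) (length L) (list L) ≡ 0
    enough = trans
      (cong (a (node-code s) *_) (m≤n⇒m∸n≡0
        (subst (λ n → H ≤ count (λ i → member (child (node-code s) i) (length L) (list L)) (g n)) (sym (fst-pair _ _))
          (≤-trans le (count-mono (g (length s)) λ i i<g pos →
            subst (λ e → 0 < member e (length L) (list L)) (sym (child-node-code s i)) (cL i i<g (i<g , pos)))))))
      (*-zeroʳ (a (node-code s)))

-- The partial recursive diagonal function

module Diagonal (G : Fn 1) where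

  g : ℕ → ℕ
  g n = fun G (n ∷ [])

  open Trees g public

  outputsTest : ℕ → ℕ → ℕ → ℕ → ℕ
  outputsTest p m v e = dist (result p m (fst e) (snd e)) (pair 0 v)

  module Cert p m v H = Certificates g (outputsTest p m v) H

  InA⇒Outputs : ∀ p m v H s → Cert.InA p m v H s → Outputs p m v s
  InA⇒Outputs p m v H s eq = subst₂ (λ n σ → result p m n σ ≡ pair 0 v)
    (fst-pair (length s) (code s)) (snd-pair (length s) (code s)) (dist≡0⇒≡ _ _ eq)

  Outputs⇒InA : ∀ p m v H s → Outputs p m v s → Cert.InA p m v H s
  Outputs⇒InA p m v H s eq = subst₂ (λ n σ → dist (result p m n σ) (pair 0 v) ≡ 0)
    (sym (fst-pair (length s) (code s))) (sym (snd-pair (length s) (code s)))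
    (trans (cong (λ r → dist r (pair 0 v)) eq) (dist-refl (pair 0 v)))

  memberFn : Fn 3
  memberFn = sumFn (const 1 ⊖ distFn (var v1) (fstFn (app (iterFn (sndFn (var v0))) (var v0 ∷ var v2 ∷ []))))

  badFn : Fn 7
  badFn = distFn (app resultFn (var v3 ∷ var v4 ∷ fstFn (var v0) ∷ sndFn (var v0) ∷ [])) (pairFn zeroFn (var v5)) ⊛
    (var v6 ⊖ app countFn (app G (fstFn (var v0) ∷ []) ∷ var v0 ∷ var v1 ∷ var v2 ∷ []))
    where
    countFn : Fn 4
    countFn = sumFn (sgnFn (app memberFn
      (var v2 ∷ pairFn (sucFn (fstFn (var v1))) (pairFn (sndFn (var v1)) (var v0)) ∷ var v3 ∷ [])))

  invalidFn : Fn 7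
  invalidFn = sumFn (app badFn
    (fstFn rest ∷ var v1 ⊖ sucFn (var v0) ∷ sndFn rest ∷ var v3 ∷ var v4 ∷ var v5 ∷ var v6 ∷ []))
    where
    rest : Fn 7
    rest = app (iterFn (sndFn (var v0))) (var v0 ∷ var v2 ∷ [])

  -- Zero exactly when the list is valid and e occurs in it.
  check : ℕ → ℕ → ℕ → ℕ → ℕ → ℕ → ℕ → ℕ
  check p m v H e ℓ D = Cert.invalid p m v H ℓ D + (1 ∸ member e ℓ D)

  checkFn : Fn 7
  checkFn = retarget (app invalidFn (var v5 ∷ var v5 ∷ var v6 ∷ var v0 ∷ var v1 ∷ var v2 ∷ var v3 ∷ []) ⊕
      (const 1 ⊖ app memberFn (var v5 ∷ var v4 ∷ var v6 ∷ [])))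
    (λ { (p ∷ m ∷ v ∷ H ∷ e ∷ ℓ ∷ D ∷ []) → check p m v H e ℓ D })
    λ { (p ∷ m ∷ v ∷ H ∷ e ∷ ℓ ∷ D ∷ []) → refl }

  -- Because a and b are part of the input x, the place a x + b can be computed from x alone.
  query : ℕ → ℕ → ℕ → ℕ → String → ℕ
  query p a b H s = pair p (pair a (pair b (pair H (node-code s))))

  -- A candidate d codes an output v together with the length and the code of a certificate.
  testFn : Fn 2
  testFn = app checkFn (fstFn x ∷ fstFn (sndFn x) ⊛ x ⊕ fstFn (sndFn (sndFn x)) ∷ fstFn d ∷
    fstFn (sndFn (sndFn (sndFn x))) ∷ sndFn (sndFn (sndFn (sndFn x))) ∷ fstFn (sndFn d) ∷ sndFn (sndFn d) ∷ [])
    where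
    d x : Fn 2
    d = var v0
    x = var v1

  testFn-query : ∀ d p a b H s → fun testFn (d ∷ query p a b H s ∷ []) ≡
    check p (a * query p a b H s + b) (fst d) H (node-code s) (fst (snd d)) (snd (snd d))
  testFn-query d p a b H s = helper
    (fst-pair p (pair a (pair b (pair H (node-code s))))) (snd-pair p (pair a (pair b (pair H (node-code s)))))
    (fst-pair a (pair b (pair H (node-code s)))) (snd-pair a (pair b (pair H (node-code s))))
    (fst-pair b (pair H (node-code s))) (snd-pair b (pair H (node-code s)))
    (fst-pair H (node-code s)) (snd-pair H (node-code s))
    where
    helper : ∀ {x p a b H e y z w} → fst x ≡ p → snd x ≡ y → fst y ≡ a → snd y ≡ z → fst z ≡ b → snd z ≡ w →
      fst w ≡ H → snd w ≡ e →
      fun testFn (d ∷ x ∷ []) ≡ check p (a * x + b) (fst d) H e (fst (snd d)) (snd (snd d))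
    helper refl refl refl refl refl refl refl refl = refl

  opaque
    diagonal : Program ⊥ 1
    diagonal = search testFn (fstFn (var v0))

    diagonal⇓ : ∀ x d → fun testFn (d ∷ x ∷ []) ≡ 0 →
      ∃[ d₀ ] fun testFn (d₀ ∷ x ∷ []) ≡ 0 × noOracle ⊢ diagonal [ x ∷ [] ]⇓ fst d₀
    diagonal⇓ x d = search⇓ testFn (fstFn (var v0)) (x ∷ []) d

  -- On input query p a b H s the diagonal function looks for an output v of program p
  -- on a x + b, where x is the input itself, that is forced by H-big many extensions of s.
  Diag : Rel ℕ 0ℓ
  Diag x y = noOracle ⊢ diagonal [ x ∷ [] ]⇓ y

  accepted : ∀ d p a b H s → let m = a * query p a b H s + b in
    fun testFn (d ∷ query p a b H s ∷ []) ≡ 0 → Big H (Outputs p m (fst d)) s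
  accepted d p a b H s ok = Big-map (InA⇒Outputs p m (fst d) H)
    (Cert.certified p m (fst d) H (fst (snd d)) (snd (snd d)) (m+n≡0⇒m≡0 _ ok′) s
      (m∸n≡0⇒m≤n (m+n≡0⇒n≡0 (Cert.invalid p m (fst d) H (fst (snd d)) (snd (snd d))) ok′)))
    where
    m : ℕ
    m = a * query p a b H s + b
    ok′ : check p m (fst d) H (node-code s) (fst (snd d)) (snd (snd d)) ≡ 0
    ok′ = trans (sym (testFn-query d p a b H s)) ok

  accepts : ∀ p a b H s v L → let m = a * query p a b H s + b in
    Cert.Valid p m v H L → Cert.Contains p m v H L s →
    fun testFn (pair v (pair (length L) (list L)) ∷ query p a b H s ∷ []) ≡ 0
  accepts p a b H s v L valid contains = trans (testFn-query _ p a b H s) (trans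
    (helper (fst-pair _ _) (snd-pair _ _) (fst-pair _ _) (snd-pair _ _))
    (cong₂ _+_ valid (m≤n⇒m∸n≡0 contains)))
    where
    m : ℕ
    m = a * query p a b H s + b
    helper : ∀ {d v y ℓ D} → fst d ≡ v → snd d ≡ y → fst y ≡ ℓ → snd y ≡ D →
      check p m (fst d) H (node-code s) (fst (snd d)) (snd (snd d)) ≡ check p m v H (node-code s) ℓ D
    helper refl refl refl refl = refl

  -- The value v′ found first need not be v, but its accepted certificate shows that it is forced by
  -- H-big many extensions as well.
  Diag-finds : ∀ p a b H s {v} → let m = a * query p a b H s + b in
    Big H (Outputs p m v) s → ∃[ v′ ] Diag (query p a b H s) v′ × Big H (Outputs p m v′) s
  Diag-finds p a b H s {v} big
    with L , valid , contains ← Cert.certificate p (a * query p a b H s + b) v H (Big-map (Outputs⇒InA p _ v H) big)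
    with d , ok , h ← diagonal⇓ (query p a b H s) (pair v (pair (length L) (list L)))
      (accepts p a b H s v L valid contains) =
    fst d , h , accepted d p a b H s ok

-- A function with long plateaus and high jumps

module Growth (Q : Fn 1) where

  q̂ : ℕ → ℕ
  q̂ m = fun Q (m ∷ [])

  -- For strings of length n with code at most E, and for p, a, b, H at most n, this
  -- bounds H + q̂ (a x + b) H, where x is the query made of these data.
  demand : ℕ → ℕ → ℕ
  demand n E = n + sum q̂ (suc (n * x + n)) * n
    where
    x : ℕ
    x = pair n (pair n (pair n (pair n (pair n E))))

  -- growth takes each of its values c exactly c times, remaining counts down the rest of
  -- the current plateau, and codeBound n bounds the codes of the strings of length n below growth.
  mutual
    growth : ℕ → ℕ
    -- The start 2 keeps all values above 1 and suits the first set to avoid, which is not 2-big.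
    growth zero    = 2
    growth (suc n) = ifz (remaining n) (growth n + demand (suc n) (codeBound (suc n))) (growth n)

    remaining : ℕ → ℕ
    remaining zero    = 1
    -- A jump to c is itself the first of c positions, hence `pred`.
    remaining (suc n) = ifz (remaining n) (pred (growth (suc n))) (pred (remaining n))

    codeBound : ℕ → ℕ
    codeBound zero    = 0
    codeBound (suc n) = pair (codeBound n) (growth n)

  demandFn : Fn 2
  demandFn = n ⊕ app (sumFn (app Q (var v0 ∷ []))) (sucFn (n ⊛ x ⊕ n) ∷ []) ⊛ n
    where
    n x : Fn 2
    n = var v0
    x = pairFn n (pairFn n (pairFn n (pairFn n (pairFn n (var v1)))))

  -- The mutual recursion becomes one primitive recursion on a coded triple.
  stateFn : Fn 1
  stateFn = fn₁ (recur (pairFn zeroFn (pairFn (const 2) (const 1))) (pairFn E (pairFn c (ifzFn r (predFn c) (predFn r)))))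
    (λ n → pair (codeBound n) (pair (growth n) (remaining n)))
    (natrec-cong (λ n → pair (codeBound n) (pair (growth n) (remaining n))) refl
      λ n → helper n (fst-pair (codeBound n) (pair (growth n) (remaining n)))
        (snd-pair (codeBound n) (pair (growth n) (remaining n)))
        (fst-pair (growth n) (remaining n)) (snd-pair (growth n) (remaining n)))
    where
    E c r : Fn 2
    E = pairFn (fstFn (var v1)) (fstFn (sndFn (var v1)))
    r = sndFn (sndFn (var v1))
    c = ifzFn r (fstFn (sndFn (var v1)) ⊕ app demandFn (sucFn (var v0) ∷ E ∷ [])) (fstFn (sndFn (var v1)))
    helper : ∀ n {x y} → fst x ≡ codeBound n → snd x ≡ y → fst y ≡ growth n → snd y ≡ remaining n →
      fun (pairFn E (pairFn c (ifzFn r (predFn c) (predFn r)))) (n ∷ x ∷ []) ≡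
      pair (codeBound (suc n)) (pair (growth (suc n)) (remaining (suc n)))
    helper n {x} e refl e₂ e₃ rewrite e | e₂ | e₃ = refl

  growthFn : Fn 1
  growthFn = fn₁ (fstFn (sndFn (app stateFn (var v0 ∷ [])))) growth λ n →
    trans (cong fst (snd-pair _ _)) (fst-pair _ _)

  growth-suc : ∀ n → growth n ≤ growth (suc n)
  growth-suc n with remaining n
  ... | zero  = m≤m+n _ _
  ... | suc _ = ≤-refl

  growth-mono : ∀ {m n} → m ≤ n → growth m ≤ growth n
  growth-mono {n = zero}  z≤n = ≤-refl
  growth-mono {n = suc n} m≤sn with m≤n⇒m<n∨m≡n m≤sn
  ... | inj₁ m<sn = ≤-trans (growth-mono (s≤s⁻¹ m<sn)) (growth-suc n)
  ... | inj₂ refl = ≤-refl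

  2≤growth : ∀ n → 2 ≤ growth n
  2≤growth n = growth-mono {0} {n} z≤n

  growth-jump : ∀ {n} → remaining n ≡ 0 → demand (suc n) (codeBound (suc n)) ≤ growth (suc n)
  growth-jump {n} eq rewrite eq = m≤n+m _ _

  plateau : ∀ n j {k} → remaining n ≡ j + k → growth (n + j) ≡ growth n × remaining (n + j) ≡ k
  plateau n zero    eq rewrite +-identityʳ n = refl , eq
  plateau n (suc j) {k} eq rewrite +-suc n j
    with c , r ← plateau n j {suc k} (trans eq (sym (+-suc j k))) rewrite r = c , refl

  plateau-end : ∀ n → ∃[ m ] n ≤ m × remaining m ≡ 0
  plateau-end n = n + remaining n , m≤m+n _ _ , proj₂ (plateau n (remaining n) (sym (+-identityʳ _)))

  -- The full length c of a plateau with value c makes its reciprocals add up to 1.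
  next-plateau : ∀ {n} → remaining n ≡ 0 →
    remaining (n + growth (suc n)) ≡ 0 × (∀ j → j < growth (suc n) → growth (suc n + j) ≡ growth (suc n))
  next-plateau {n} eq = last (growth (suc n)) refl , λ j j<c → proj₁ (plateau (suc n) j
    (trans start (sym (m+[n∸m]≡n (<⇒≤pred j<c)))))
    where
    start : remaining (suc n) ≡ pred (growth (suc n))
    start = subst (λ r → ifz r (pred (growth (suc n))) (pred r) ≡ pred (growth (suc n))) (sym eq) refl
    last : ∀ c → growth (suc n) ≡ c → remaining (n + c) ≡ 0
    last zero    eq′ with () ← subst (2 ≤_) eq′ (2≤growth (suc n))
    last (suc c) eq′ = subst (λ m → remaining m ≡ 0) (sym (+-suc n c))
      (proj₂ (plateau (suc n) c (trans start (trans (cong pred eq′) (sym (+-identityʳ c))))))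

  growth-unbounded : ∀ B → ∃[ n ] B ≤ growth n
  growth-unbounded zero    = 0 , z≤n
  growth-unbounded (suc B) with n , le ← growth-unbounded B with m , n≤m , eq ← plateau-end n =
    suc m , ≤-trans (s≤s (≤-trans le (growth-mono n≤m))) (larger eq)
    where
    larger : remaining m ≡ 0 → suc (growth m) ≤ growth (suc m)
    -- The jump adds the demand, whose first summand `suc m` is positive.
    larger eq rewrite eq = subst (_≤ growth m + demand (suc m) (codeBound (suc m))) (+-comm (growth m) 1)
      (+-monoʳ-≤ (growth m) (s≤s z≤n))

  open Diagonal growthFn public

  code-≤ : ∀ {s} → [] ⊑ s → code s ≤ codeBound (length s)
  code-≤ ⊑-refl      = z≤n
  code-≤ (⊑-∷ p i<g) = pair-mono (code-≤ p) (<⇒≤ i<g)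

  -- By monotonicity of `pair` the query is at most the number x in `demand`. As `q̂` is not assumed
  -- monotone, its value is bounded by the sum of all values up to the largest possible place.
  demand-met : ∀ {n p a b H s} → remaining n ≡ 0 → [] ⊑ s → length s ≡ suc n →
    p ≤ suc n → a ≤ suc n → b ≤ suc n → H ≤ suc n →
    H + q̂ (a * query p a b H s + b) * H ≤ growth (suc n)
  demand-met {n} {p} {a} {b} {H} {s} eq root len p≤n a≤n b≤n H≤n = ≤-trans
    (+-mono-≤ H≤n (*-mono-≤
      (term≤sum q̂ (s≤s (+-mono-≤ (*-mono-≤ a≤n
        (pair-mono p≤n (pair-mono a≤n (pair-mono b≤n (pair-mono H≤n
          (pair-mono (≤-reflexive len) (subst (λ l → code s ≤ codeBound l) len (code-≤ root)))))))) b≤n))) H≤n))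
    (growth-jump eq)

-- Rational and real estimates

ι : ℕ → ℚ
ι n = ℤ.+ n ℚ./ 1

/-≤-ι : ∀ {z n} d → z ℤ.≤ ℤ.+ n → z ℚ./ suc d ℚ.≤ ι n
/-≤-ι {z} {n} d z≤+n = ℚ.toℚᵘ-cancel-≤ (begin
  ℚ.toℚᵘ (z ℚ./ suc d)  ≃⟨ ℚ.toℚᵘ-fromℚᵘ (mkℚᵘ z d) ⟩
  mkℚᵘ z d              ≤⟨ *≤* (ℤ.≤-trans (ℤ.≤-reflexive (ℤ.*-identityʳ z)) (ℤ.≤-trans z≤+n
                             (ℤ.≤-trans (ℤ.+≤+ (m≤m*n n (suc d))) (ℤ.≤-reflexive (ℤ.pos-* n (suc d)))))) ⟩
  mkℚᵘ (ℤ.+ n) 0          ≃⟨ ℚ.toℚᵘ-fromℚᵘ (mkℚᵘ (ℤ.+ n) 0) ⟨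
  ℚ.toℚᵘ (ι n)          ∎)
  where open ℚᵘ.≤-Reasoning

ι-mono : ∀ {m n} → m ≤ n → ι m ℚ.≤ ι n
ι-mono m≤n = /-≤-ι 0 (ℤ.+≤+ m≤n)

ι-suc : ∀ n → ι (suc n) ≡ 1ℚ ℚ.+ ι n
ι-suc n = ℚ.toℚᵘ-injective (begin
  ℚ.toℚᵘ (ι (suc n))             ≈⟨ ℚ.toℚᵘ-fromℚᵘ (mkℚᵘ (ℤ.+ suc n) 0) ⟩
  mkℚᵘ (ℤ.+ suc n) 0               ≈⟨ *≡* (cong (λ z → (ℤ.1ℤ ℤ.+ z) ℤ.* ℤ.1ℤ) (sym (ℤ.*-identityʳ (ℤ.+ n)))) ⟩
  mkℚᵘ (ℤ.+ 1) 0 ℚᵘ.+ mkℚᵘ (ℤ.+ n) 0 ≈⟨ ℚᵘ.+-congʳ (mkℚᵘ (ℤ.+ 1) 0) (ℚᵘ.≃-sym (ℚ.toℚᵘ-fromℚᵘ (mkℚᵘ (ℤ.+ n) 0))) ⟩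
  mkℚᵘ (ℤ.+ 1) 0 ℚᵘ.+ ℚ.toℚᵘ (ι n) ≈⟨ ℚᵘ.≃-sym (ℚ.toℚᵘ-homo-+ 1ℚ (ι n)) ⟩
  ℚ.toℚᵘ (1ℚ ℚ.+ ι n)            ∎)
  where open import Relation.Binary.Reasoning.Setoid ℚᵘ.≃-setoid

+1≤ι : ∀ p m n → p ℚ.≤ ι m → m < n → p ℚ.+ 1ℚ ℚ.≤ ι n
+1≤ι p m n p≤m m<n = begin
  p ℚ.+ 1ℚ    ≤⟨ ℚ.+-monoˡ-≤ 1ℚ p≤m ⟩
  ι m ℚ.+ 1ℚ  ≡⟨ ℚ.+-comm (ι m) 1ℚ ⟩
  1ℚ ℚ.+ ι m  ≡⟨ ι-suc m ⟨
  ι (suc m)   ≤⟨ ι-mono {suc m} {n} m<n ⟩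
  ι n         ∎
  where open ℚ.≤-Reasoning

≤-ι : ∀ p → ∃[ n ] p ℚ.≤ ι n
≤-ι p@record{} = ℤ.∣ ℚ.numerator p ∣ ,
  subst (ℚ._≤ ι ℤ.∣ ℚ.numerator p ∣) (ℚ.↥p/↧p≡p p) (/-≤-ι (ℚ.denominator-1 p) (≤∣∣ (ℚ.numerator p)))
  where
  ≤∣∣ : ∀ z → z ℤ.≤ ℤ.+ ℤ.∣ z ∣
  ≤∣∣ (ℤ.+ n)    = ℤ.≤-refl
  ≤∣∣ ℤ.-[1+ n ] = ℤ.-≤+

0<1 : 0ℚ ℚ.< 1ℚ
0<1 = ℚ.positive⁻¹ 1ℚ

p<p+ε : ∀ p {ε} → 0ℚ ℚ.< ε → p ℚ.< p ℚ.+ ε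
p<p+ε p 0<ε = subst (ℚ._< p ℚ.+ _) (ℚ.+-identityʳ p) (ℚ.+-monoʳ-< p 0<ε)

≤⇒≤ℝ : ∀ {p q} → p ℚ.≤ q → fromℚ p ≤ℝ fromℚ q
≤⇒≤ℝ {p} {q} p≤q (ε , 0<ε , N , h) =
  ℚ.<-irrefl refl (ℚ.<-≤-trans (ℚ.≤-<-trans p≤q (p<p+ε q 0<ε)) (h N ≤-refl))

real-bound : ∀ (x : ℝ) → ∃[ M ] ∃[ N ] (∀ k → N ≤ k → seq x k ℚ.≤ ι M)
real-bound x with N , h ← cauchy x 1ℚ 0<1 with M , le ← ≤-ι (1ℚ ℚ.+ seq x N) =
  M , N , λ k N≤k → ℚ.≤-trans (close (seq x k) (seq x N) (h k N N≤k ≤-refl)) le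
  where
  ≤∣∣ : ∀ p → p ℚ.≤ ℚ.∣ p ∣
  ≤∣∣ p with ℚ.≤-total 0ℚ p
  ... | inj₁ 0≤p = ℚ.≤-reflexive (sym (ℚ.0≤p⇒∣p∣≡p 0≤p))
  ... | inj₂ p≤0 = ℚ.≤-trans p≤0 (ℚ.0≤∣p∣ p)
  close : ∀ p q → ℚ.∣ p ℚ.- q ∣ ℚ.< 1ℚ → p ℚ.≤ 1ℚ ℚ.+ q
  close p q lt = subst (ℚ._≤ 1ℚ ℚ.+ q) (solve 2 (λ p q → (p :- q) :+ q := p) refl p q)
    (ℚ.+-monoˡ-≤ q (ℚ.≤-trans (≤∣∣ (p ℚ.- q)) (ℚ.<⇒≤ lt)))
    where open +-*-Solver

module _ {f : ℕ → ℝ} (uc : UniformlyComputable f) where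

  private
    a b d : ℕ → ℕ → ℕ
    a = proj₁ (proj₁ (proj₂ uc))
    b = proj₁ (proj₂ (proj₁ (proj₂ uc)))
    d = proj₁ (proj₂ (proj₂ (proj₁ (proj₂ uc))))
    a-computable : Computable₂ a
    a-computable = proj₁ (proj₂ (proj₂ (proj₂ (proj₁ (proj₂ uc)))))

  boundFn : Fn 1
  boundFn = sucFn (app (mkFn (λ { (m ∷ n ∷ []) → a m n }) (proj₁ a-computable)
    λ { (m ∷ n ∷ []) → proj₂ a-computable m n }) (var v0 ∷ zeroFn ∷ []))

  -- Precision `2^- 0` = 1 is enough: r = (a - b)/(d + 1) is at most a, so f m ≤ r + 1 ≤ a + 1, and
  -- x < f m rules out x ≥ a + 1.
  <ℝ⇒<bound : ∀ m x → fromℕ x <ℝ f m → x < fun boundFn (m ∷ [])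
  <ℝ⇒<bound m x (ε , 0<ε , N , h) with x <? fun boundFn (m ∷ [])
  ... | yes lt = lt
  ... | no ≮ = ⊥-elim (proj₂ (proj₂ (proj₂ uc) m 0) (ε , 0<ε , N , λ k N≤k →
    ℚ.≤-trans (ℚ.+-monoˡ-≤ ε r+1≤x) (h k N≤k)))
    where
    r : ℚ
    r = proj₁ uc m 0
    r≡ : r ≡ (a m 0 ℤ.⊖ b m 0) ℚ./ suc (d m 0)
    r≡ = proj₂ (proj₂ (proj₂ (proj₂ (proj₂ (proj₂ (proj₁ (proj₂ uc))))))) m 0
    r≤a : r ℚ.≤ ι (a m 0)
    r≤a = subst (ℚ._≤ ι (a m 0)) (sym r≡) (/-≤-ι (d m 0) (ℤ.m⊖n≤m (a m 0) (b m 0)))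
    r+1≤x : r ℚ.+ 1ℚ ℚ.≤ ι x
    r+1≤x = +1≤ι r (a m 0) x r≤a (≮⇒≥ ≮)

-- Growth as a slow-growing order function

module SlowOrder (Q : Fn 1) where

  open Growth Q

  slow : ℕ → ℝ>1
  slow n = fromℕ (growth n) , 1ℚ , 0<1 , 0 , λ _ _ →
    subst (ℚ._≤ ι (growth n)) (ι-suc 1) (ι-mono {2} {growth n} (2≤growth n))

  0≤2^- : ∀ k → 0ℚ ℚ.≤ 2^- k
  0≤2^- k = ℚ.nonNegative⁻¹ (2^- k) {{ℚ.normalize-nonNeg 1 (2 ^ k) {{m^n≢0 2 k}}}}

  constant-≤ℝ : ∀ x k → fromℚ (ι x ℚ.- 2^- k) ≤ℝ fromℕ x × fromℕ x ≤ℝ fromℚ (ι x ℚ.+ 2^- k)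
  constant-≤ℝ x k =
    ≤⇒≤ℝ {ι x ℚ.- 2^- k} {ι x} (subst (ι x ℚ.- 2^- k ℚ.≤_) (ℚ.+-identityʳ (ι x))
      (ℚ.+-monoʳ-≤ (ι x) (ℚ.neg-antimono-≤ (0≤2^- k)))) ,
    ≤⇒≤ℝ {ι x} {ι x ℚ.+ 2^- k} (subst (ℚ._≤ ι x ℚ.+ 2^- k) (ℚ.+-identityʳ (ι x))
      (ℚ.+-monoʳ-≤ (ι x) (0≤2^- k)))

  growth-computable : Computable₂ (λ n _ → growth n)
  growth-computable = prog growthFn₂ , λ m n → correct growthFn₂ (m ∷ n ∷ [])
    where
    growthFn₂ : Fn 2
    growthFn₂ = app growthFn (var v0 ∷ [])

  zero-computable : Computable₂ (λ _ _ → 0)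
  zero-computable = prog (zeroFn {2}) , λ m n → correct (zeroFn {2}) (m ∷ n ∷ [])

  ι-≡ : ∀ x → ι x ≡ (x ℤ.⊖ 0) ℚ./ 1
  ι-≡ x = refl

  slow-computable : UniformlyComputable (proj₁ ∘ slow)
  slow-computable = (λ n _ → ι (growth n)) ,
    ((λ n _ → growth n) , (λ _ _ → 0) , (λ _ _ → 0) ,
      growth-computable , zero-computable , zero-computable , λ m _ → ι-≡ (growth m)) ,
    λ n k → constant-≤ℝ (growth n) k

  slow-unbounded : ∀ B → ∃[ n ] B <ℝ proj₁ (slow n)
  slow-unbounded B = let (M , N , h) = real-bound B ; (n , le) = growth-unbounded (suc M) in
    n , 1ℚ , 0<1 , N , λ k N≤k → +1≤ι (seq B k) M (growth n) (h k N≤k) le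

  slow-order : IsOrderFunction (proj₁ ∘ slow)
  slow-order = record
    { computable    = slow-computable
    ; nondecreasing = λ m n m≤n → ≤⇒≤ℝ {ι (growth m)} {ι (growth n)} (ι-mono (growth-mono m≤n))
    ; unbounded     = slow-unbounded
    }

  recip : ℕ → ℚ
  recip n = recipMax1 (ι (growth n))

  -- The values of `slow` are constant sequences, so each partial sum has the same rational at every
  -- index.
  recipSum : ℕ → ℚ
  recipSum zero    = 0ℚ
  recipSum (suc n) = recipSum n ℚ.+ recip n

  seq-partialSum : ∀ n k → seq (partialSum (λ n → slow n ⁻¹) n) k ≡ recipSum n
  seq-partialSum zero    k = refl
  seq-partialSum (suc n) k = cong (ℚ._+ recip n) (seq-partialSum n k)

  1≤growth : ∀ n → 1ℚ ℚ.≤ ι (growth n)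
  1≤growth n = ι-mono {1} {growth n} (≤-trans (s≤s z≤n) (2≤growth n))

  growth-positive : ∀ n → ℚ.Positive (1ℚ ℚ.⊔ ι (growth n))
  growth-positive n = ℚ.positive (ℚ.<-≤-trans 0<1 (ℚ.p≤p⊔q 1ℚ (ι (growth n))))

  recip-nonneg : ∀ n → 0ℚ ℚ.≤ recip n
  recip-nonneg n = ℚ.<⇒≤ (ℚ.positive⁻¹ (recip n) {{ℚ.1/pos⇒pos (1ℚ ℚ.⊔ ι (growth n)) {{growth-positive n}}}})

  growth*recip : ∀ n → ι (growth n) ℚ.* recip n ≡ 1ℚ
  growth*recip n = trans (cong (ℚ._* recip n) (sym (ℚ.p≤q⇒p⊔q≡q (1≤growth n))))
    (ℚ.*-inverseʳ (1ℚ ℚ.⊔ ι (growth n)) {{ℚ.pos⇒nonZero (1ℚ ℚ.⊔ ι (growth n)) {{growth-positive n}}}})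

  recipSum-≤-+ : ∀ m k → recipSum m ℚ.≤ recipSum (k + m)
  recipSum-≤-+ m zero    = ℚ.≤-refl
  recipSum-≤-+ m (suc k) = ℚ.≤-trans (recipSum-≤-+ m k)
    (subst (ℚ._≤ recipSum (k + m) ℚ.+ recip (k + m)) (ℚ.+-identityʳ (recipSum (k + m)))
      (ℚ.+-monoʳ-≤ (recipSum (k + m)) (recip-nonneg (k + m))))

  recipSum-mono : ∀ {m n} → m ≤ n → recipSum m ℚ.≤ recipSum n
  recipSum-mono {m} {n} m≤n = subst (λ k → recipSum m ℚ.≤ recipSum k) (m∸n+n≡m m≤n) (recipSum-≤-+ m (n ∸ m))

  recipSum-plateau : ∀ m k → (∀ j → j < k → growth (m + j) ≡ growth m) →
    recipSum (m + k) ≡ recipSum m ℚ.+ ι k ℚ.* recip m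
  recipSum-plateau m zero h = trans (cong recipSum (+-identityʳ m))
    (solve 2 (λ s r → s := s :+ con 0ℚ :* r) refl (recipSum m) (recip m))
    where open +-*-Solver
  recipSum-plateau m (suc k) h = begin
    recipSum (m + suc k)                                   ≡⟨ cong recipSum (+-suc m k) ⟩
    recipSum (m + k) ℚ.+ recip (m + k)                     ≡⟨ cong₂ ℚ._+_ (recipSum-plateau m k λ j j<k → h j (m≤n⇒m≤1+n j<k))
                                                                (cong (λ c → recipMax1 (ι c)) (h k ≤-refl)) ⟩
    (recipSum m ℚ.+ ι k ℚ.* recip m) ℚ.+ recip m           ≡⟨ solve 3 (λ s i r → (s :+ i :* r) :+ r := s :+ (con 1ℚ :+ i) :* r) refl
                                                                (recipSum m) (ι k) (recip m) ⟩
    recipSum m ℚ.+ (1ℚ ℚ.+ ι k) ℚ.* recip m                ≡⟨ cong (λ i → recipSum m ℚ.+ i ℚ.* recip m) (sym (ι-suc k)) ⟩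
    recipSum m ℚ.+ ι (suc k) ℚ.* recip m ∎
    where
    open ≡-Reasoning
    open +-*-Solver

  -- Induction over plateaus, each of which adds c · 1/c = 1.
  recipSum-unbounded : ∀ B → ∃[ n ] remaining n ≡ 0 × ι B ℚ.≤ recipSum (suc n)
  recipSum-unbounded zero = let (n , _ , eq) = plateau-end 0 in n , eq , recipSum-mono {0} {suc n} z≤n
  recipSum-unbounded (suc B) = let
      (n , eq , le)        = recipSum-unbounded B
      (end , constant)     = next-plateau {n} eq
    in n + growth (suc n) , end , (begin
      ι (suc B)                                                  ≡⟨ trans (ι-suc B) (ℚ.+-comm 1ℚ (ι B)) ⟩
      ι B ℚ.+ 1ℚ                                                 ≤⟨ ℚ.+-monoˡ-≤ 1ℚ le ⟩
      recipSum (suc n) ℚ.+ 1ℚ                                    ≡⟨ cong (recipSum (suc n) ℚ.+_) (sym (growth*recip (suc n))) ⟩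
      recipSum (suc n) ℚ.+ ι (growth (suc n)) ℚ.* recip (suc n)  ≡⟨ sym (recipSum-plateau (suc n) (growth (suc n)) constant) ⟩
      recipSum (suc n + growth (suc n))                          ∎)
    where open ℚ.≤-Reasoning

  slow-growing : SlowGrowing slow
  slow-growing B = let (M , N , h) = real-bound B ; (n , _ , le) = recipSum-unbounded (suc M) in
    suc n , λ m n<m → 1ℚ , 0<1 , N , λ k N≤k → (begin
      seq B k ℚ.+ 1ℚ                               ≤⟨ +1≤ι (seq B k) M (suc M) (h k N≤k) ≤-refl ⟩
      ι (suc M)                                    ≤⟨ le ⟩
      recipSum (suc n)                             ≤⟨ recipSum-mono n<m ⟩
      recipSum m                                   ≡⟨ sym (seq-partialSum m k) ⟩
      seq (partialSum (λ n → slow n ⁻¹) m) k       ∎)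
    where open ℚ.≤-Reasoning

-- The forcing construction

module Forcing (em : ExcludedMiddle 0ℓ) (Q : Fn 1) where

  open Growth Q

  -- The initial segment stem, together with the promise to stay out of avoided.
  record Condition : Set₁ where
    field
      stem    : String
      root    : [] ⊑ stem
      H       : ℕ
      avoided : String → Set
      small   : ¬ Big H avoided stem
      -- This lets the stem grow: with at least H children available, one of them keeps the set
      -- small.
      fits    : ∀ n → length stem ≤ n → H ≤ growth n

  open Condition

  -- Evaluation is deterministic, so a 2-big set of hits would by `Big-Hits` put a hit into the
  -- empty string.
  initial : Condition
  initial = record
    { stem    = []
    ; root    = ⊑-refl
    ; H       = 2
    ; avoided = Hits Universal
    ; small   = λ big → no-hit (Big-Hits deterministic big)
    ; fits    = λ n _ → 2≤growth n
    }
    where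
    no-hit : ¬ Hits Universal []
    no-hit (_ , () , _)

  -- Either p outputs at a x + b the value of the diagonal function at x, or no output below `q̂`
  -- remains possible there. Both defeat p.
  Requirement : ℕ → ℕ → ℕ → Condition → Set
  Requirement p a b c = ∃[ x ]
    ((∃[ v ] Diag x v × Outputs p (a * x + b) v (stem c)) ⊎
     (∀ v τ → v < q̂ (a * x + b) → Outputs p (a * x + b) v τ → avoided c τ))

  record _≼_ (c c′ : Condition) : Set where
    field
      stem-⊑   : stem c ⊑ stem c′
      avoided-⊆ : ∀ τ → avoided c τ → avoided c′ τ

  open _≼_

  ≼-refl : ∀ {c} → c ≼ c
  ≼-refl = record { stem-⊑ = ⊑-refl ; avoided-⊆ = λ _ → id }

  ≼-trans : ∀ {c d e} → c ≼ d → d ≼ e → c ≼ e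
  ≼-trans p q = record
    { stem-⊑    = ⊑-trans (stem-⊑ p) (stem-⊑ q)
    ; avoided-⊆ = λ τ → avoided-⊆ q τ ∘ avoided-⊆ p τ
    }

  Meets : ℕ → ℕ → ℕ → Condition → Condition → Set
  Meets p a b c c′ = c ≼ c′ × length (stem c) < length (stem c′) × Requirement p a b c′

  meet-at : ∀ p a b c n → remaining n ≡ 0 → length (stem c) < suc n →
    p ≤ suc n → a ≤ suc n → b ≤ suc n → H c ≤ suc n → ∃ (Meets p a b c)
  meet-at p a b c n end len< p≤ a≤ b≤ H≤ = decide em
    where
    extension : ∃[ τ ] stem c ⊑ τ × length τ ≡ (suc n ∸ length (stem c)) + length (stem c) × ¬ Big (H c) (avoided c) τ
    -- The stem is first brought to the length `suc n` of the jump; only then is the query formed,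
    -- since it codes the stem.
    extension = ¬Big-extend em (small c) (fits c) (suc n ∸ length (stem c))
    τ : String
    τ = proj₁ extension
    stem⊑τ : stem c ⊑ τ
    stem⊑τ = proj₁ (proj₂ extension)
    len : length τ ≡ suc n
    len = trans (proj₁ (proj₂ (proj₂ extension))) (m∸n+n≡m (<⇒≤ len<))
    ¬big : ¬ Big (H c) (avoided c) τ
    ¬big = proj₂ (proj₂ (proj₂ extension))
    x m : ℕ
    x = query p a b (H c) τ
    m = a * x + b
    decide : Dec (∃[ v ] Big (H c) (Outputs p m v) τ) → ∃ (Meets p a b c)
    decide (yes (v , big)) = let
        (v′ , d , big′)       = Diag-finds p a b (H c) τ big
        (υ , τ⊑υ , out , ¬bυ) = ¬Big-meet em ¬big big′
        stem⊑υ                = ⊑-trans stem⊑τ τ⊑υ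
      in record
        { stem    = υ
        ; root    = ⊑-trans (root c) stem⊑υ
        ; H       = H c
        ; avoided = avoided c
        ; small   = ¬bυ
        ; fits    = λ n le → fits c n (≤-trans (⊑-length stem⊑υ) le)
        } ,
        record { stem-⊑ = stem⊑υ ; avoided-⊆ = λ _ → id } ,
        ≤-trans len< (≤-trans (≤-reflexive (sym len)) (⊑-length τ⊑υ)) ,
        x , inj₁ (v′ , d , out)
    decide (no ¬large) = record
        { stem    = τ
        ; root    = ⊑-trans (root c) stem⊑τ
        ; H       = H c + q̂ m * H c
        ; avoided = λ υ → avoided c υ ⊎ (∃[ v ] v < q̂ m × Outputs p m v υ)
        ; small   = Big-⋃ ¬big (λ v big → ¬large (v , big)) (q̂ m)
        -- The jump at `suc n` leaves room for this larger bound, and `growth` never decreases.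
        ; fits    = λ k le → ≤-trans
            (demand-met end (⊑-trans (root c) stem⊑τ) len p≤ a≤ b≤ H≤)
            (growth-mono (≤-trans (≤-reflexive (sym len)) le))
        } ,
        record { stem-⊑ = stem⊑τ ; avoided-⊆ = λ _ → inj₁ } ,
        ≤-trans len< (≤-reflexive (sym len)) ,
        x , inj₂ (λ v υ v<q̂ out → inj₂ (v , v<q̂ , out))

  meet : ∀ p a b c → ∃ (Meets p a b c)
  -- The sum is a common bound for the length and all data; n is the end of a plateau past it.
  meet p a b c = let (n , large , end) = plateau-end (l + (p + (a + (b + H c)))) in
    meet-at p a b c n end
      (s≤s (≤-trans (m≤m+n l _) large))
      (below large (≤-trans (m≤m+n p _) (m≤n+m _ l)))
      (below large (≤-trans (m≤m+n a _) (≤-trans (m≤n+m _ p) (m≤n+m _ l))))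
      (below large (≤-trans (m≤m+n b _) (≤-trans (m≤n+m _ a) (≤-trans (m≤n+m _ p) (m≤n+m _ l)))))
      (below large (≤-trans (m≤n+m (H c) b) (≤-trans (m≤n+m _ a) (≤-trans (m≤n+m _ p) (m≤n+m _ l)))))
    where
    l : ℕ
    l = length (stem c)
    below : ∀ {N n k} → N ≤ n → k ≤ N → k ≤ suc n
    below N≤n k≤N = m≤n⇒m≤1+n (≤-trans k≤N N≤n)

  meet-coded : ∀ i c → ∃ (Meets (fst i) (fst (snd i)) (snd (snd i)) c)
  meet-coded i = meet (fst i) (fst (snd i)) (snd (snd i))

  -- Stage i treats the triple (p, a, b) read off i, and every triple has a code.
  chain : ℕ → Condition
  chain zero    = initial
  chain (suc i) = proj₁ (meet-coded i (chain i))

  chain-mono : ∀ {i j} → i ≤ j → chain i ≼ chain j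
  chain-mono {i} {j} i≤j = subst (λ k → chain i ≼ chain k) (m∸n+n≡m i≤j) (steps (j ∸ i))
    where
    steps : ∀ d → chain i ≼ chain (d + i)
    steps zero    = ≼-refl
    steps (suc d) = ≼-trans (steps d) (proj₁ (proj₂ (meet-coded (d + i) (chain (d + i)))))

  chain-length : ∀ i → i ≤ length (stem (chain i))
  chain-length zero    = z≤n
  chain-length (suc i) = ≤-trans (s≤s (chain-length i)) (proj₁ (proj₂ (proj₂ (meet-coded i (chain i)))))

  chain-requirement : ∀ p a b → Requirement p a b (chain (suc (pair p (pair a b))))
  chain-requirement p a b = helper {chain (suc i)} (fst-pair p (pair a b)) (snd-pair p (pair a b))
    (proj₂ (proj₂ (proj₂ (meet-coded i (chain i)))))
    where
    i : ℕ
    i = pair p (pair a b)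
    helper : ∀ {c p′ y} → p′ ≡ p → y ≡ pair a b → Requirement p′ (fst y) (snd y) c → Requirement p a b c
    helper {c} refl refl r = subst₂ (λ a b → Requirement p a b c) (fst-pair a b) (snd-pair a b) r

  generic : ℕ → ℕ
  -- By `chain-length` this stem has length at least `suc k`, so position k is defined.
  generic k = at (stem (chain (suc k))) k

  generic-at : ∀ i k → k < length (stem (chain i)) → generic k ≡ at (stem (chain i)) k
  generic-at i k k<len with ≤-total (suc k) i
  ... | inj₁ sk≤i = sym (⊑-at (stem-⊑ (chain-mono sk≤i)) (chain-length (suc k)))
  ... | inj₂ i≤sk = ⊑-at (stem-⊑ (chain-mono i≤sk)) k<len

  generic-< : ∀ k → generic k < growth k
  generic-< k = ⊑-at-< (root (chain (suc k))) (chain-length (suc k))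

  -- Avoided sets only grow along the chain, and a stem in its own avoided set would be a one-leaf
  -- tree.
  ¬avoided : ∀ i j → i ≤ j → ¬ avoided (chain i) (stem (chain j))
  ¬avoided i j i≤j bad = small (chain j) (leaf (avoided-⊆ (chain-mono i≤j) (stem (chain j)) bad))

  generic-avoids : ∀ k y → Universal k y → ¬ generic k ≡ y
  generic-avoids k y u eq = ¬avoided 0 (suc k) z≤n (k , chain-length (suc k) , subst (Universal k) (sym eq) u)

  generic-requirement : ∀ (e : Program ⊤ 1) (Z : ℕ → ℕ) → (∀ n → (λ _ → generic) ⊢ e [ n ∷ [] ]⇓ Z n) →
    ∀ a b → ∃[ x ] (Diag x (Z (a * x + b)) ⊎ ¬ Z (a * x + b) < q̂ (a * x + b))
  generic-requirement e Z computes a b = x , [ forced , excluded ]′ (proj₂ req)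
    where
    i : ℕ
    i = suc (pair (encode e) (pair a b))
    req : Requirement (encode e) a b (chain i)
    req = chain-requirement (encode e) a b
    x m : ℕ
    x = proj₁ req
    m = a * x + b
    forced : (∃[ v ] Diag x v × Outputs (encode e) m v (stem (chain i))) → Diag x (Z m) ⊎ ¬ Z m < q̂ m
    forced (v , d , out) = inj₁ (subst (Diag x) (deterministic
      (Outputs⇒⇓ {e = e} {s = stem (chain i)} (λ _ → generic-at i) out) (computes m)) d)
    excluded : (∀ v τ → v < q̂ m → Outputs (encode e) m v τ → avoided (chain i) τ) → Diag x (Z m) ⊎ ¬ Z m < q̂ m
    excluded avoid = inj₂ λ Z<q̂ → let
        (N , outputs) = ⇓⇒Outputs (computes m)
        -- Stage j is late enough to contain the whole computation and to inherit the promise made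
        -- at stage i.
        j             = N ⊔ i
      in ¬avoided i j (m≤n⊔m N i) (avoid (Z m) (stem (chain j)) Z<q̂
           (outputs (stem (chain j)) (λ _ → generic-at j) (≤-trans (m≤m⊔n N i) (chain-length j))))

-- Refuting the reduction

module _ (em : ExcludedMiddle 0ℓ) (Q : Fn 1) where

  open SlowOrder Q
  open Growth Q
  open Forcing em Q

  generic-<ℝ : ∀ n → fromℕ (generic n) <ℝ proj₁ (slow n)
  generic-<ℝ n = 1ℚ , 0<1 , 0 , λ _ _ →
    +1≤ι (ι (generic n)) (generic n) (growth n) ℚ.≤-refl (generic-< n)

  generic∈LUA : LUA slow generic
  generic∈LUA = generic-<ℝ , Universal , (universal , λ x y → mk⇔ id id) , Universal-linear ,
    λ (n , y , u , eq) → generic-avoids n y u eq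

  generic∈LUAslow : LUAslow generic
  generic∈LUAslow = slow , slow-order , slow-growing , generic∈LUA

  -- The linearly universal ψ that Z avoids copies `Diag` along some x ↦ a x + b. At one such place
  -- Z meets ψ or breaks its bound.
  LUA≰LUAslow : ∀ (q : ℕ → ℝ>1) → (∀ m x → fromℕ x <ℝ proj₁ (q m) → x < q̂ m) → ¬ LUA q ≤w LUAslow
  LUA≰LUAslow q q<q̂ LUAq≤LUAslow = no-reduction (LUAq≤LUAslow generic generic∈LUAslow)
    where
    no-reduction : ¬ (∃[ Z ] Z ∈ LUA q × Z ≤T generic)
    no-reduction (Z , (Z<q , ψ , _ , ψ-universal , Z-avoids) , e , computes) =
      refute (ψ-universal Diag (diagonal , λ x y → mk⇔ id id))
      where
      refute : ¬ (∃[ a ] ∃[ b ] (∀ x y → ψ (a * x + b) y ⇔ Diag x y))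
      refute (a , b , ψ≃Diag) = impossible (generic-requirement e Z computes a b)
        where
        impossible : ¬ (∃[ x ] (Diag x (Z (a * x + b)) ⊎ ¬ Z (a * x + b) < q̂ (a * x + b)))
        impossible (x , inj₁ d)  = Z-avoids (a * x + b , _ , Equivalence.from (ψ≃Diag x _) d , refl)
        impossible (x , inj₂ ≮q̂) = ≮q̂ (q<q̂ _ _ (Z<q (a * x + b)))

mainTheorem8 : ExcludedMiddle 0ℓ →
    ¬ (Σ[ q ∈ (ℕ → ℝ>1) ] (IsOrderFunction (proj₁ ∘ q) × LUAslow ≡w LUA q))
mainTheorem8 em (q , q-order , _ , LUAq≤LUAslow) =
  LUA≰LUAslow em (boundFn {proj₁ ∘ q} uc) q (<ℝ⇒<bound {proj₁ ∘ q} uc) LUAq≤LUAslow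
  where
  uc : UniformlyComputable (proj₁ ∘ q)
  uc = IsOrderFunction.computable q-order
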